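{- In the randomized ANY model with $n$ agents, asymptotically almost surely (as $n\to\infty$): 1. the number of calls until two fixed agents exchange their secrets is $\frac12 n\log n\cdot(1+o(1))$; 2. the number of calls until at least one of the agents becomes an expert is $n\log n\cdot(1+o(1))$; 3. the number of calls until a fixed agent becomes an expert is $n\log n\cdot(1+o(1))$; 4. the number of calls until all agents become experts is $\frac32 n\log n\cdot(1+o(1))$.
   Context: There are $n$ agents, each initially knowing a single distinct secret. Agents communicate by a sequence of calls between pairs of distinct agents; in each call the two agents exchange all secrets they currently know. An agent who knows all $n$ secrets is an expert. Two fixed agents have exchanged their secrets once each knows the secret of the other. In the randomized ANY model, each call is between a pair of distinct agents chosen uniformly at random among all $\binom n2$ pairs, independently of all previous calls (repetitions allowed). $\log$ is the natural logarithm. A statement "$X=f(n)(1+o(1))$ a.a.s." means that for every $\delta>0$, $\mathbb P[(1-\delta)f(n)\le X\le(1+\delta)f(n)]\to1$ as $n\to\infty$. -}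

module Defs where

open import Data.Bool using (Bool; true; false; _∧_; _∨_; not; if_then_else_)
open import Data.Nat using (ℕ; zero; suc; _+_; _*_; _^_; _≤_; _<?_; _≤?_)
open import Data.Fin using (Fin; toℕ) renaming (_≟_ to _≟ᶠ_)
open import Data.List using (List; []; _∷_; length; filter; concatMap; map; take; upTo; allFin)
open import Data.Product using (_×_; _,_; proj₁; proj₂; Σ; ∃)
open import Relation.Nullary.Decidable using (⌊_⌋)
open import Data.Bool.ListAction using (all; any)
open import Data.Bool.Properties using (T?)
open import Data.Bool using (T)

-- Exponential series, used to encode inequalities involving log n.
--   expA k j = j! * Σ_{i ≤ j} k^i / i!   (a natural number)
-- so  Σ_{i≤j} k^i/i! ≤ N  iff  expA k j ≤ N * j!.

expA : ℕ → ℕ → ℕ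
expA k zero    = 1
expA k (suc j) = suc j * expA k j + k ^ suc j

fact : ℕ → ℕ
fact zero    = 1
fact (suc j) = suc j * fact j

-- e^k ≤ N  (every partial sum of the exponential series is ≤ N)
ExpLe : ℕ → ℕ → Set
ExpLe k N = ∀ j → expA k j ≤ N * fact j

-- N ≤ e^k  (some partial sum reaches N; exact since e^k ∉ ℕ for k ≥ 1)
ExpGe : ℕ → ℕ → Set
ExpGe k N = ∃ λ j → N * fact j ≤ expA k j

-- a call: an (unordered) pair {i , j} of distinct agents, stored with i < j
Call : ℕ → Set
Call n = Fin n × Fin n

pairs : (n : ℕ) → List (Call n)
pairs n = filter (λ p → toℕ (proj₁ p) <? toℕ (proj₂ p))
                 (concatMap (λ i → map (λ j → (i , j)) (allFin n)) (allFin n))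

-- all call sequences of length t (each equally likely in the ANY model)
seqs : (n t : ℕ) → List (List (Call n))
seqs n zero    = [] ∷ []
seqs n (suc t) = concatMap (λ c → map (c ∷_) (seqs n t)) (pairs n)

-- K a s = true  iff agent a knows the secret of agent s
Know : ℕ → Set
Know n = Fin n → Fin n → Bool

initial : ∀ {n} → Know n
initial a s = ⌊ a ≟ᶠ s ⌋

step : ∀ {n} → Call n → Know n → Know n
step (i , j) K a =
  if ⌊ a ≟ᶠ i ⌋ ∨ ⌊ a ≟ᶠ j ⌋ then (λ s → K i s ∨ K j s) else K a

run : ∀ {n} → Know n → List (Call n) → Know n
run K []       = K
run K (c ∷ cs) = run (step c K) cs

stateAt : ∀ {n} → List (Call n) → ℕ → Know n
stateAt σ t = run initial (take t σ)

firstHit : ∀ {n} → (Know n → Bool) → List (Call n) → ℕ → Bool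
firstHit P σ t = P (stateAt σ t) ∧ all (λ t' → not (P (stateAt σ t'))) (upTo t)

-- event  lo ≤ X ≤ hi  (decided on sequences of length ≥ hi)
inWindow : ∀ {n} → (Know n → Bool) → ℕ → ℕ → List (Call n) → Bool
inWindow P lo hi σ = any (λ t → ⌊ lo ≤? t ⌋ ∧ firstHit P σ t) (upTo (suc hi))

countWindow : (n : ℕ) → (Know n → Bool) → ℕ → ℕ → ℕ
countWindow n P lo hi = length (filter (λ σ → T? (inWindow P lo hi σ)) (seqs n hi))

expert : ∀ {n} → Fin n → Know n → Bool
expert {n} a K = all (K a) (allFin n)

someExpert : ∀ {n} → Know n → Bool
someExpert {n} K = any (λ a → expert a K) (allFin n)

allExperts : ∀ {n} → Know n → Bool
allExperts {n} K = all (λ a → expert a K) (allFin n)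

exchanged : ∀ {n} → Fin n → Fin n → Know n → Bool
exchanged a b K = K a b ∧ K b a

-- Window n P Q d k X :
--   with c = P/Q, δ = 1/(d+1), ε = 1/(k+1), f(n) = c · n · log n,
--   P[(1-δ) f(n) ≤ X ≤ (1+δ) f(n)] ≥ 1 - ε,
-- where X is the number of calls until property X first holds.
-- Encoded via integer endpoints lo ≤ hi of the window:
--   lo ≥ (1-δ) c n log n  ⇔  e^{lo·Q·(d+1)} ≥ n^{P·d·n}
--   hi ≤ (1+δ) c n log n  ⇔  e^{hi·Q·(d+1)} ≤ n^{P·(d+2)·n}
-- and  Prob = countWindow / (#pairs)^hi.

Window : (n P Q d k : ℕ) → (Know n → Bool) → Set
Window n P Q d k X =
  Σ ℕ λ lo → Σ ℕ λ hi →
      ExpGe (lo * Q * suc d) (n ^ (P * d * n))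
    × ExpLe (hi * Q * suc d) (n ^ (P * (suc (suc d)) * n))
    × k * length (pairs n) ^ hi ≤ suc k * countWindow n X lo hi

{-# OPTIONS --safe #-}
-- All tail bounds are first moment bounds. Reading a call sequence backwards, the set of agents whose
-- secret ends up at a fixed agent grows like an infection: a set of size m grows with
-- probability m (n - m) / N per call, where N is the number of pairs. Hence:
--   * agent a knows the secret of b after t calls with probability at most (1 + n/N)^t / n;
--   * a potential of the form 1 / (m - 1 + ε), killed once b is informed, shows that a does not know
--     the secret of b with probability at most about (n/ε) exp(-2t / (n (1 + ε))), and union bounds over
--     1, n or n² pairs give the three upper times with f(n) = ½, 1 and 3/2 times n log n;
--   * a potential with increments (m + s)(n - m + s) / m (n - m) shows that a given agent is an expert
--     by time (1 - δ) n log n with probability O(n^{-2sδ}), and a union over the agents gives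
--     the lower bound for the first expert;
--   * with high probability some agent takes no part in the last (1 - δ) ½ n log n calls (potential
--     1 / (u + 3) for u untouched agents), so all agents being experts at (1 - δ) 3/2 n log n
--     would make that agent an expert already at time (1 - δ) n log n.
-- Logarithms are taken to a base that is a power of (M + 1)/M, with M depending on δ only.
module Submission where

open import Defs
open import Data.Bool using (Bool; true; false; T; not; _∧_; _∨_; if_then_else_)
open import Data.Bool.ListAction using (all; any)
open import Data.Bool.Properties using (T?; T-≡; T-∧; ∨-zeroʳ)
open import Data.Fin using (Fin; zero; suc; toℕ) renaming (_≟_ to _≟ᶠ_)
open import Data.List using (List; []; _∷_; _++_; length; filter; concatMap; map; take; drop; allFin; tabulate)
open import Data.List.Membership.Propositional using (lose)
open import Data.List.Membership.Propositional.Properties using (∈-allFin; ∈-upTo⁺; ∈-upTo⁻)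
open import Data.List.Properties using (length-tabulate)
open import Data.List.Relation.Unary.All as All using (All; []; _∷_)
open import Data.List.Relation.Unary.All.Properties using (all⁺; all⁻; all-filter)
open import Data.List.Relation.Unary.Any.Properties using (any⁺)
open import Data.Nat using (ℕ; zero; suc; pred; _+_; _*_; _^_; _≤_; _<_; _≤?_; _<?_; _≡ᵇ_; z≤n; s≤s)
open import Data.Nat using (NonZero; >-nonZero; >-nonZero⁻¹)
open import Data.Nat.Properties
open import Data.Nat.Tactic.RingSolver using (solve-∀)
open import Data.Product using (Σ; ∃; _×_; _,_; proj₁; proj₂)
open import Function using (_∘_; id)
open import Function.Bundles using (Equivalence)
open import Relation.Binary.PropositionalEquality
  using (_≡_; _≢_; refl; sym; trans; cong; cong₂; subst; subst₂; module ≡-Reasoning)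
open import Relation.Nullary using (Dec; yes; no; does; contradiction)
open import Relation.Nullary.Decidable using (⌊_⌋; fromWitness)

-- Truncated exponentials of fractions

-- Forwards in time, being an expert involves n coupled infections, one per secret; backwards it is
-- one infection reaching everyone. The potentials are chosen so that their relative drift per call
-- is independent of the current size m. For the late tail, 1 / (m - 1), killed at b, would have
-- relative drift exactly -(n - 1) / N, but it is infinite at the start m = 1; the ε repairs this at
-- the cost of a factor 1 / (1 + ε) in the rate. For an early expert, (m + s)(n - m + s) - m (n - m)
-- = s (n + s) is free of m. For untouched agents, the mean of u alone cannot show that u is
-- positive; the reciprocal turns u = 0 into a large value, so Markov's inequality replaces the
-- usual variance estimate. All arithmetic is in ℕ: probabilities are counts of sequences, and each
-- potential is multiplied by a common denominator. Powers of e and powers of n are compared through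
-- β = (M + 1) / M and e^(1/(M + 1)) ≤ β ≤ e^(1/M).

^-distribʳ-* : ∀ o m n → (m * n) ^ o ≡ m ^ o * n ^ o
^-distribʳ-* zero    m n = refl
^-distribʳ-* (suc o) m n rewrite ^-distribʳ-* o m n = lemma m n (m ^ o) (n ^ o)
  where
  lemma : ∀ m n x y → m * n * (x * y) ≡ m * x * (n * y)
  lemma = solve-∀

fact-nonZero : ∀ j → NonZero (fact j)
fact-nonZero zero    = _
fact-nonZero (suc j) = m*n≢0 (suc j) (fact j) {{_}} {{fact-nonZero j}}

-- expQ x q j = q^j j! Σ_{i≤j} (x/q)^i/i!, the truncated exponential of the fraction x/q.
expQ : ℕ → ℕ → ℕ → ℕ
expQ x q zero    = 1
expQ x q (suc j) = suc j * q * expQ x q j + x ^ suc j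

expQ-expA : ∀ x q j → expQ (q * x) q j ≡ q ^ j * expA x j
expQ-expA x q zero    = refl
expQ-expA x q (suc j)
  rewrite expQ-expA x q j | ^-distribʳ-* (suc j) q x = lemma (suc j) q (q ^ j) (expA x j) (x ^ suc j)
  where
  lemma : ∀ k q qj a xj → k * q * (qj * a) + q * qj * xj ≡ q * qj * (k * a + xj)
  lemma = solve-∀

expQ-zero : ∀ q j → expQ 0 q j ≡ q ^ j * fact j
expQ-zero q zero    = refl
expQ-zero q (suc j) rewrite expQ-zero q j = lemma (suc j) q (q ^ j) (fact j)
  where
  lemma : ∀ k q qj f → k * q * (qj * f) + 0 ≡ q * qj * (k * f)
  lemma = solve-∀

expQ-mono : ∀ a q b l j → a * l ≤ b * q → expQ a q j * l ^ j ≤ expQ b l j * q ^ j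
expQ-mono a q b l zero    h = ≤-refl
expQ-mono a q b l (suc j) h = begin
  (suc j * q * expQ a q j + a ^ suc j) * l ^ suc j
    ≡⟨ lemma (suc j) q (expQ a q j) (a ^ suc j) l (l ^ j) ⟩
  suc j * q * l * (expQ a q j * l ^ j) + a ^ suc j * l ^ suc j
    ≡⟨ cong (suc j * q * l * (expQ a q j * l ^ j) +_) (^-distribʳ-* (suc j) a l) ⟨
  suc j * q * l * (expQ a q j * l ^ j) + (a * l) ^ suc j
    ≤⟨ +-mono-≤ (*-monoʳ-≤ (suc j * q * l) (expQ-mono a q b l j h)) (^-monoˡ-≤ (suc j) h) ⟩
  suc j * q * l * (expQ b l j * q ^ j) + (b * q) ^ suc j
    ≡⟨ cong₂ _+_ (lemma′ (suc j) q l (expQ b l j * q ^ j)) (^-distribʳ-* (suc j) b q) ⟩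
  suc j * l * q * (expQ b l j * q ^ j) + b ^ suc j * q ^ suc j
    ≡⟨ lemma (suc j) l (expQ b l j) (b ^ suc j) q (q ^ j) ⟨
  (suc j * l * expQ b l j + b ^ suc j) * q ^ suc j ∎
  where
  open ≤-Reasoning
  lemma : ∀ k q e a l lj → (k * q * e + a) * (l * lj) ≡ k * q * l * (e * lj) + a * (l * lj)
  lemma = solve-∀
  lemma′ : ∀ k q l x → k * q * l * x ≡ k * l * q * x
  lemma′ = solve-∀

-- The tangent at y to the convex function x^(i+1); `bernoulli-upper` uses the tangent at y + p.
-- Applied to each term of the series they give the two `expQ-step` bounds.
bernoulli-lower : ∀ y p i → y ^ suc i + suc i * p * y ^ i ≤ (y + p) ^ suc i
bernoulli-lower y p zero    = ≤-reflexive (lemma y p)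
  where
  lemma : ∀ y p → y * 1 + 1 * p * 1 ≡ (y + p) * 1
  lemma = solve-∀
bernoulli-lower y p (suc i) = begin
  y ^ suc (suc i) + suc (suc i) * p * y ^ suc i
    ≤⟨ m≤m+n _ (suc i * p * p * y ^ i) ⟩
  y ^ suc (suc i) + suc (suc i) * p * y ^ suc i + suc i * p * p * y ^ i
    ≡⟨ lemma y p i (y ^ i) ⟩
  (y + p) * (y ^ suc i + suc i * p * y ^ i)
    ≤⟨ *-monoʳ-≤ (y + p) (bernoulli-lower y p i) ⟩
  (y + p) ^ suc (suc i) ∎
  where
  open ≤-Reasoning
  lemma : ∀ y p i z → y * (y * z) + (1 + (1 + i)) * p * (y * z) + (1 + i) * p * p * z
        ≡ (y + p) * (y * z + (1 + i) * p * z)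
  lemma = solve-∀

bernoulli-upper : ∀ y p i → (y + p) ^ suc i ≤ y ^ suc i + suc i * p * (y + p) ^ i
bernoulli-upper y p zero    = ≤-reflexive (lemma y p)
  where
  lemma : ∀ y p → (y + p) * 1 ≡ y * 1 + 1 * p * 1
  lemma = solve-∀
bernoulli-upper y p (suc i) = begin
  (y + p) * (y + p) ^ suc i
    ≡⟨ *-distribʳ-+ ((y + p) ^ suc i) y p ⟩
  y * (y + p) ^ suc i + p * (y + p) ^ suc i
    ≤⟨ +-monoˡ-≤ _ (*-monoʳ-≤ y (bernoulli-upper y p i)) ⟩
  y * (y ^ suc i + suc i * p * (y + p) ^ i) + p * (y + p) ^ suc i
    ≤⟨ m≤m+n _ (suc i * p * p * (y + p) ^ i) ⟩
  y * (y ^ suc i + suc i * p * (y + p) ^ i) + p * (y + p) ^ suc i + suc i * p * p * (y + p) ^ i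
    ≡⟨ lemma y p i (y ^ suc i) ((y + p) ^ i) ⟩
  y ^ suc (suc i) + suc (suc i) * p * (y + p) ^ suc i ∎
  where
  open ≤-Reasoning
  lemma : ∀ y p i z w → y * (z + (1 + i) * p * w) + p * ((y + p) * w) + (1 + i) * p * p * w
        ≡ y * z + (1 + (1 + i)) * p * ((y + p) * w)
  lemma = solve-∀

-- In this scaling the derivative in y of the truncation of degree j + 1 is j + 1 times the
-- truncation of degree j, so this is again a tangent bound at y, and `expQ-step-upper` one at y +
-- p.
expQ-step-lower : ∀ y p q j → expQ y q (suc j) + suc j * p * expQ y q j ≤ expQ (y + p) q (suc j)
expQ-step-lower y p q zero    = ≤-reflexive (lemma y p q)
  where
  lemma : ∀ y p q → 1 * q * 1 + y * 1 + 1 * p * 1 ≡ 1 * q * 1 + (y + p) * 1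
  lemma = solve-∀
expQ-step-lower y p q (suc j) = begin
  suc (suc j) * q * e₁ + y ^ suc (suc j) + suc (suc j) * p * (suc j * q * e₀ + y ^ suc j)
    ≡⟨ lemma (suc (suc j)) (suc j) q e₁ (y ^ suc (suc j)) p e₀ (y ^ suc j) ⟩
  suc (suc j) * q * (e₁ + suc j * p * e₀) + (y ^ suc (suc j) + suc (suc j) * p * y ^ suc j)
    ≤⟨ +-mono-≤ (*-monoʳ-≤ (suc (suc j) * q) (expQ-step-lower y p q j)) (bernoulli-lower y p (suc j)) ⟩
  expQ (y + p) q (suc (suc j)) ∎
  where
  open ≤-Reasoning
  e₀ = expQ y q j
  e₁ = expQ y q (suc j)
  lemma : ∀ k l q e z p f w → k * q * e + z + k * p * (l * q * f + w)
        ≡ k * q * (e + l * p * f) + (z + k * p * w)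
  lemma = solve-∀

expQ-step-upper : ∀ y p q j →
  expQ (y + p) q (suc j) ≤ expQ y q (suc j) + suc j * p * expQ (y + p) q j
expQ-step-upper y p q zero    = ≤-reflexive (lemma y p q)
  where
  lemma : ∀ y p q → 1 * q * 1 + (y + p) * 1 ≡ 1 * q * 1 + y * 1 + 1 * p * 1
  lemma = solve-∀
expQ-step-upper y p q (suc j) = begin
  suc (suc j) * q * expQ (y + p) q (suc j) + (y + p) ^ suc (suc j)
    ≤⟨ +-mono-≤ (*-monoʳ-≤ (suc (suc j) * q) (expQ-step-upper y p q j)) (bernoulli-upper y p (suc j)) ⟩
  suc (suc j) * q * (e₁ + suc j * p * e₀) + (y ^ suc (suc j) + suc (suc j) * p * (y + p) ^ suc j)
    ≡⟨ lemma (suc (suc j)) (suc j) q e₁ (y ^ suc (suc j)) p e₀ ((y + p) ^ suc j) ⟨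
  suc (suc j) * q * e₁ + y ^ suc (suc j) + suc (suc j) * p * (suc j * q * e₀ + (y + p) ^ suc j) ∎
  where
  open ≤-Reasoning
  e₀ = expQ (y + p) q j
  e₁ = expQ y q (suc j)
  lemma : ∀ k l q e z p f w → k * q * e + z + k * p * (l * q * f + w)
        ≡ k * q * (e + l * p * f) + (z + k * p * w)
  lemma = solve-∀

-- Each further factor 1 + p/q is paid for by one tangent step, which raises the degree by one. The
-- explicit degree n later serves as the witness in `ExpGe`.
[1+p/q]^n≤exp : ∀ p q n → (q + p) ^ n * fact n ≤ expQ (n * p) q n
[1+p/q]^n≤exp p q zero    = ≤-refl
[1+p/q]^n≤exp p q (suc n) = begin
  (q + p) * (q + p) ^ n * (suc n * fact n)
    ≡⟨ lemma (q + p) ((q + p) ^ n) (suc n) (fact n) ⟩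
  suc n * (q + p) * ((q + p) ^ n * fact n)
    ≤⟨ *-monoʳ-≤ (suc n * (q + p)) ([1+p/q]^n≤exp p q n) ⟩
  suc n * (q + p) * expQ (n * p) q n
    ≡⟨ lemma′ (suc n) q p (expQ (n * p) q n) ⟩
  suc n * q * expQ (n * p) q n + suc n * p * expQ (n * p) q n
    ≤⟨ +-monoˡ-≤ (suc n * p * expQ (n * p) q n) (m≤m+n _ _) ⟩
  expQ (n * p) q (suc n) + suc n * p * expQ (n * p) q n
    ≤⟨ expQ-step-lower (n * p) p q n ⟩
  expQ (n * p + p) q (suc n)
    ≡⟨ cong (λ y → expQ y q (suc n)) (+-comm (n * p) p) ⟩
  expQ (suc n * p) q (suc n) ∎
  where
  open ≤-Reasoning
  lemma : ∀ a b k f → a * b * (k * f) ≡ k * a * (b * f)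
  lemma = solve-∀
  lemma′ : ∀ k q p e → k * (q + p) * e ≡ k * q * e + k * p * e
  lemma′ = solve-∀

-- A truncated exponential dominates its own derivative, so the tangent bound at y + p loses at most
-- the fraction p / (q + p). The degree j does not change, so the bound iterates for every j, as
-- `ExpLe` demands.
expQ-shrink : ∀ y p q j → q * expQ (y + p) (q + p) j ≤ (q + p) * expQ y (q + p) j
expQ-shrink y p q zero    = *-monoˡ-≤ 1 (m≤m+n q p)
expQ-shrink y p q (suc j) = +-cancelʳ-≤ (p * e₁) _ _ (begin
  q * e₁ + p * e₁                          ≡⟨ *-distribʳ-+ e₁ q p ⟨
  (q + p) * e₁                             ≤⟨ *-monoʳ-≤ (q + p) (expQ-step-upper y p (q + p) j) ⟩
  (q + p) * (e + suc j * p * e₀)           ≡⟨ lemma (q + p) e (suc j) p e₀ ⟩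
  (q + p) * e + p * (suc j * (q + p) * e₀) ≤⟨ +-monoʳ-≤ ((q + p) * e) (*-monoʳ-≤ p (m≤m+n _ _)) ⟩
  (q + p) * e + p * e₁                     ∎)
  where
  open ≤-Reasoning
  e₁ = expQ (y + p) (q + p) (suc j)
  e₀ = expQ (y + p) (q + p) j
  e  = expQ y (q + p) (suc j)
  lemma : ∀ l e k p f → l * (e + k * p * f) ≡ l * e + p * (k * l * f)
  lemma = solve-∀

exp≤[1-p/l]^-n : ∀ p q n j →
  expQ (n * p) (q + p) j * q ^ n ≤ (q + p) ^ n * ((q + p) ^ j * fact j)
exp≤[1-p/l]^-n p q zero    j = ≤-reflexive (begin
  expQ 0 (q + p) j * 1         ≡⟨ *-identityʳ _ ⟩
  expQ 0 (q + p) j             ≡⟨ expQ-zero (q + p) j ⟩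
  (q + p) ^ j * fact j         ≡⟨ *-identityˡ _ ⟨
  1 * ((q + p) ^ j * fact j)   ∎)
  where open ≡-Reasoning
exp≤[1-p/l]^-n p q (suc n) j = begin
  expQ (p + n * p) l j * (q * q ^ n)
    ≡⟨ cong (λ y → expQ y l j * (q * q ^ n)) (+-comm p (n * p)) ⟩
  expQ (n * p + p) l j * (q * q ^ n)
    ≡⟨ lemma (expQ (n * p + p) l j) q (q ^ n) ⟩
  q * expQ (n * p + p) l j * q ^ n
    ≤⟨ *-monoˡ-≤ (q ^ n) (expQ-shrink (n * p) p q j) ⟩
  l * expQ (n * p) l j * q ^ n
    ≡⟨ *-assoc l _ _ ⟩
  l * (expQ (n * p) l j * q ^ n)
    ≤⟨ *-monoʳ-≤ l (exp≤[1-p/l]^-n p q n j) ⟩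
  l * (l ^ n * (l ^ j * fact j))
    ≡⟨ *-assoc l _ _ ⟨
  l * l ^ n * (l ^ j * fact j) ∎
  where
  open ≤-Reasoning
  l = q + p
  lemma : ∀ a b c → a * (b * c) ≡ b * a * c
  lemma = solve-∀

-- (1 + p/q)^m ≤ e^{pm/q} ≤ e^{p'm'/l} ≤ (1 - p'/l)^{-m'} with l = q' + p'.
power-comparison : ∀ p q m p′ q′ m′ .{{_ : NonZero (q′ + p′)}} →
  p * m * (q′ + p′) ≤ p′ * m′ * q →
  (q + p) ^ m * q′ ^ m′ ≤ q ^ m * (q′ + p′) ^ m′
power-comparison p q m p′ q′ m′ h =
  *-cancelʳ-≤ _ _ (fact m * l ^ m)
    {{m*n≢0 (fact m) (l ^ m) {{fact-nonZero m}} {{m^n≢0 l m}}}} (begin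
  (q + p) ^ m * q′ ^ m′ * (fact m * l ^ m)
    ≡⟨ lemma₁ ((q + p) ^ m) (q′ ^ m′) (fact m) (l ^ m) ⟩
  (q + p) ^ m * fact m * (l ^ m * q′ ^ m′)
    ≤⟨ *-monoˡ-≤ (l ^ m * q′ ^ m′) ([1+p/q]^n≤exp p q m) ⟩
  expQ (m * p) q m * (l ^ m * q′ ^ m′)
    ≡⟨ *-assoc (expQ (m * p) q m) (l ^ m) (q′ ^ m′) ⟨
  expQ (m * p) q m * l ^ m * q′ ^ m′
    ≤⟨ *-monoˡ-≤ (q′ ^ m′) (expQ-mono (m * p) q (m′ * p′) l m
         (subst₂ (λ x y → x * l ≤ y * q) (*-comm p m) (*-comm p′ m′) h)) ⟩
  expQ (m′ * p′) l m * q ^ m * q′ ^ m′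
    ≡⟨ lemma₂ (expQ (m′ * p′) l m) (q ^ m) (q′ ^ m′) ⟩
  q ^ m * (expQ (m′ * p′) l m * q′ ^ m′)
    ≤⟨ *-monoʳ-≤ (q ^ m) (exp≤[1-p/l]^-n p′ q′ m′ m) ⟩
  q ^ m * (l ^ m′ * (l ^ m * fact m))
    ≡⟨ lemma₃ (q ^ m) (l ^ m′) (l ^ m) (fact m) ⟩
  q ^ m * l ^ m′ * (fact m * l ^ m) ∎)
  where
  open ≤-Reasoning
  l = q′ + p′
  lemma₁ : ∀ a b c d → a * b * (c * d) ≡ a * c * (d * b)
  lemma₁ = solve-∀
  lemma₂ : ∀ a b c → a * b * c ≡ b * (a * c)
  lemma₂ = solve-∀
  lemma₃ : ∀ a b c d → a * (b * (c * d)) ≡ a * b * (d * c)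
  lemma₃ = solve-∀

-- Rests on (1 + 1/M)^M ≤ e, whereas `power⇒ExpLe` rests on e ≤ (1 + 1/M)^(M + 1). The discrepancy
-- between the two exponents is what a large M makes harmless.
power⇒ExpGe : ∀ M .{{_ : NonZero M}} x N → N * M ^ (M * x) ≤ (M + 1) ^ (M * x) → ExpGe x N
power⇒ExpGe M x N h = y , *-cancelʳ-≤ _ _ (M ^ y) {{m^n≢0 M y}} (begin
  N * fact y * M ^ y          ≡⟨ lemma N (fact y) (M ^ y) ⟩
  N * M ^ y * fact y          ≤⟨ *-monoˡ-≤ (fact y) h ⟩
  (M + 1) ^ y * fact y        ≤⟨ [1+p/q]^n≤exp 1 M y ⟩
  expQ (y * 1) M y            ≡⟨ cong (λ z → expQ z M y) (*-identityʳ y) ⟩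
  expQ (M * x) M y            ≡⟨ expQ-expA x M y ⟩
  M ^ y * expA x y            ≡⟨ *-comm (M ^ y) _ ⟩
  expA x y * M ^ y            ∎)
  where
  open ≤-Reasoning
  y = M * x
  lemma : ∀ a b c → a * b * c ≡ a * c * b
  lemma = solve-∀

power⇒ExpLe : ∀ M .{{_ : NonZero M}} x N →
  (M + 1) ^ ((M + 1) * x) ≤ N * M ^ ((M + 1) * x) → ExpLe x N
power⇒ExpLe M@(suc _) x N h j = *-cancelʳ-≤ _ _ (l ^ j * M ^ y)
    {{m*n≢0 (l ^ j) (M ^ y) {{m^n≢0 l j}} {{m^n≢0 M y}}}} (begin
  expA x j * (l ^ j * M ^ y)      ≡⟨ lemma (expA x j) (l ^ j) (M ^ y) ⟩
  l ^ j * expA x j * M ^ y        ≡⟨ cong (_* M ^ y) (expQ-expA x l j) ⟨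
  expQ y l j * M ^ y              ≡⟨ cong (λ z → expQ z l j * M ^ y) (*-identityʳ y) ⟨
  expQ (y * 1) l j * M ^ y        ≤⟨ exp≤[1-p/l]^-n 1 M y j ⟩
  l ^ y * (l ^ j * fact j)        ≤⟨ *-monoˡ-≤ (l ^ j * fact j) h ⟩
  N * M ^ y * (l ^ j * fact j)    ≡⟨ lemma′ N (M ^ y) (l ^ j) (fact j) ⟩
  N * fact j * (l ^ j * M ^ y)    ∎)
  where
  open ≤-Reasoning
  l = M + 1
  y = l * x
  lemma : ∀ a b c → a * (b * c) ≡ b * a * c
  lemma = solve-∀
  lemma′ : ∀ a b c d → a * b * (c * d) ≡ a * d * (c * b)
  lemma′ = solve-∀

-- Finite sums

⟦_⟧ : Bool → ℕ
⟦ true ⟧  = 1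
⟦ false ⟧ = 0

∑ : {A : Set} → List A → (A → ℕ) → ℕ
∑ []       f = 0
∑ (x ∷ xs) f = f x + ∑ xs f

module _ {A : Set} where

  ∑-mono-All : ∀ {f g : A → ℕ} {xs} → All (λ x → f x ≤ g x) xs → ∑ xs f ≤ ∑ xs g
  ∑-mono-All []       = z≤n
  ∑-mono-All (h ∷ hs) = +-mono-≤ h (∑-mono-All hs)

  ∑-mono : ∀ {f g : A → ℕ} xs → (∀ x → f x ≤ g x) → ∑ xs f ≤ ∑ xs g
  ∑-mono xs h = ∑-mono-All (All.universal h xs)

  ∑-cong : ∀ {f g : A → ℕ} xs → (∀ x → f x ≡ g x) → ∑ xs f ≡ ∑ xs g
  ∑-cong []       h = refl
  ∑-cong (x ∷ xs) h = cong₂ _+_ (h x) (∑-cong xs h)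

  ∑-+ : ∀ (f g : A → ℕ) xs → ∑ xs (λ x → f x + g x) ≡ ∑ xs f + ∑ xs g
  ∑-+ f g []       = refl
  ∑-+ f g (x ∷ xs) rewrite ∑-+ f g xs = lemma (f x) (g x) (∑ xs f) (∑ xs g)
    where
    lemma : ∀ a b c d → a + b + (c + d) ≡ a + c + (b + d)
    lemma = solve-∀

  ∑-*ˡ : ∀ k (f : A → ℕ) xs → ∑ xs (λ x → k * f x) ≡ k * ∑ xs f
  ∑-*ˡ k f []       = sym (*-zeroʳ k)
  ∑-*ˡ k f (x ∷ xs) = trans (cong (k * f x +_) (∑-*ˡ k f xs)) (sym (*-distribˡ-+ k (f x) (∑ xs f)))

  ∑-*ʳ : ∀ k (f : A → ℕ) xs → ∑ xs (λ x → f x * k) ≡ ∑ xs f * k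
  ∑-*ʳ k f xs = trans (∑-cong xs (λ x → *-comm (f x) k)) (trans (∑-*ˡ k f xs) (*-comm k _))

  ∑-const : ∀ k (xs : List A) → ∑ xs (λ _ → k) ≡ length xs * k
  ∑-const k []       = refl
  ∑-const k (x ∷ xs) = cong (k +_) (∑-const k xs)

  ∑-++ : ∀ (f : A → ℕ) xs ys → ∑ (xs ++ ys) f ≡ ∑ xs f + ∑ ys f
  ∑-++ f []       ys = refl
  ∑-++ f (x ∷ xs) ys = trans (cong (f x +_) (∑-++ f xs ys)) (sym (+-assoc (f x) _ _))

  ∑-filter : ∀ {P : A → Set} (P? : ∀ x → Dec (P x)) (f : A → ℕ) xs →
    ∑ (filter P? xs) f ≡ ∑ xs (λ x → ⟦ does (P? x) ⟧ * f x)
  ∑-filter P? f []       = refl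
  ∑-filter P? f (x ∷ xs) with does (P? x)
  ... | true  = cong₂ _+_ (sym (+-identityʳ (f x))) (∑-filter P? f xs)
  ... | false = ∑-filter P? f xs

  length-filter-T : ∀ (p : A → Bool) xs → length (filter (λ x → T? (p x)) xs) ≡ ∑ xs (λ x → ⟦ p x ⟧)
  length-filter-T p []       = refl
  length-filter-T p (x ∷ xs) with p x
  ... | true  = cong suc (length-filter-T p xs)
  ... | false = length-filter-T p xs

module _ {A B : Set} where

  ∑-map : ∀ (g : A → B) (f : B → ℕ) xs → ∑ (map g xs) f ≡ ∑ xs (f ∘ g)
  ∑-map g f []       = refl
  ∑-map g f (x ∷ xs) = cong (f (g x) +_) (∑-map g f xs)

  ∑-concatMap : ∀ (g : A → List B) (f : B → ℕ) xs → ∑ (concatMap g xs) f ≡ ∑ xs (λ x → ∑ (g x) f)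
  ∑-concatMap g f []       = refl
  ∑-concatMap g f (x ∷ xs) =
    trans (∑-++ f (g x) (concatMap g xs)) (cong (∑ (g x) f +_) (∑-concatMap g f xs))

  ∑-swap : ∀ (f : A → B → ℕ) xs ys →
    ∑ xs (λ x → ∑ ys (f x)) ≡ ∑ ys (λ y → ∑ xs (λ x → f x y))
  ∑-swap f []       ys = sym (trans (∑-const 0 ys) (*-zeroʳ (length ys)))
  ∑-swap f (x ∷ xs) ys =
    trans (cong (∑ ys (f x) +_) (∑-swap f xs ys)) (sym (∑-+ (f x) (λ y → ∑ xs (λ z → f z y)) ys))

  ∑-tabulate : ∀ {n} (g : Fin n → A) (h : A → B) (f : B → ℕ) →
    ∑ (tabulate (h ∘ g)) f ≡ ∑ (tabulate g) (f ∘ h)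
  ∑-tabulate {zero}  g h f = refl
  ∑-tabulate {suc n} g h f = cong (f (h (g zero)) +_) (∑-tabulate (g ∘ suc) h f)

∑ᶠ : ∀ {n} → (Fin n → ℕ) → ℕ
∑ᶠ {n} = ∑ (allFin n)

∑ᶠ-suc : ∀ {n} (f : Fin (suc n) → ℕ) → ∑ᶠ f ≡ f zero + ∑ᶠ (f ∘ suc)
∑ᶠ-suc f = cong (f zero +_) (∑-tabulate id suc f)

∑ᶠ-const : ∀ n k → ∑ᶠ {n} (λ _ → k) ≡ n * k
∑ᶠ-const n k = trans (∑-const k (allFin n)) (cong (_* k) (length-tabulate {n = n} id))

term≤∑ᶠ : ∀ {n} (f : Fin n → ℕ) i → f i ≤ ∑ᶠ f
term≤∑ᶠ f zero    = m≤m+n _ _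
term≤∑ᶠ f (suc i) = begin
  f (suc i)                ≤⟨ term≤∑ᶠ (f ∘ suc) i ⟩
  ∑ᶠ (f ∘ suc)             ≤⟨ m≤n+m _ (f zero) ⟩
  f zero + ∑ᶠ (f ∘ suc)    ≡⟨ ∑ᶠ-suc f ⟨
  ∑ᶠ f                     ∎
  where open ≤-Reasoning

δ : ∀ {n} → Fin n → Fin n → ℕ
δ a i = ⟦ ⌊ a ≟ᶠ i ⌋ ⟧

δ-suc : ∀ {n} (a i : Fin n) → δ (suc a) (suc i) ≡ δ a i
δ-suc a i with a ≟ᶠ i
... | yes _ = refl
... | no  _ = refl

∑ᶠ-δ : ∀ {n} i (y : Fin n → ℕ) → ∑ᶠ (λ a → δ a i * y a) ≡ y i
∑ᶠ-δ {suc n} zero y = begin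
  ∑ᶠ (λ a → δ a zero * y a)          ≡⟨ ∑ᶠ-suc (λ a → δ a zero * y a) ⟩
  y zero + 0 + ∑ᶠ {n} (λ _ → 0)      ≡⟨ cong₂ _+_ (+-identityʳ (y zero)) (∑ᶠ-const n 0) ⟩
  y zero + n * 0                     ≡⟨ cong (y zero +_) (*-zeroʳ n) ⟩
  y zero + 0                         ≡⟨ +-identityʳ (y zero) ⟩
  y zero                             ∎
  where open ≡-Reasoning
∑ᶠ-δ {suc n} (suc i) y = begin
  ∑ᶠ (λ a → δ a (suc i) * y a)               ≡⟨ ∑ᶠ-suc (λ a → δ a (suc i) * y a) ⟩
  ∑ᶠ (λ a → δ (suc a) (suc i) * y (suc a))
    ≡⟨ ∑-cong (allFin n) (λ a → cong (_* y (suc a)) (δ-suc a i)) ⟩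
  ∑ᶠ (λ a → δ a i * y (suc a))               ≡⟨ ∑ᶠ-δ i (y ∘ suc) ⟩
  y (suc i)                                  ∎
  where open ≡-Reasoning

∑ᶠ-δ₁ : ∀ {n} (i : Fin n) → ∑ᶠ (λ a → δ a i) ≡ 1
∑ᶠ-δ₁ {n} i = trans (∑-cong (allFin n) (λ a → sym (*-identityʳ (δ a i)))) (∑ᶠ-δ i (λ _ → 1))

-- The terms (i , j) and (j , i) of the product are gathered under i < j and the diagonal is kept
-- apart. This is how sums over calls become products of sums over agents.
∑<-product : ∀ n (x y : Fin n → ℕ) →
  ∑ᶠ (λ i → ∑ᶠ (λ j → ⟦ does (toℕ i <? toℕ j) ⟧ * (x i * y j + x j * y i)))
    + ∑ᶠ (λ i → x i * y i) ≡ ∑ᶠ x * ∑ᶠ y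
∑<-product zero    x y = refl
∑<-product (suc n) x y = begin
  ∑ᶠ (λ i → ∑ᶠ (h i)) + ∑ᶠ (λ i → x i * y i)
    ≡⟨ cong₂ _+_ (∑ᶠ-suc (λ i → ∑ᶠ (h i))) (∑ᶠ-suc (λ i → x i * y i)) ⟩
  ∑ᶠ (h zero) + ∑ᶠ (λ i → ∑ᶠ (h (suc i))) + (x₀ * y₀ + ∑ᶠ (λ i → xˢ i * yˢ i))
    ≡⟨ cong₂ (λ a b → a + b + (x₀ * y₀ + ∑ᶠ (λ i → xˢ i * yˢ i))) row₀ rows ⟩
  x₀ * ∑ᶠ yˢ + ∑ᶠ xˢ * y₀ + D + (x₀ * y₀ + ∑ᶠ (λ i → xˢ i * yˢ i))
    ≡⟨ lemma x₀ y₀ (∑ᶠ xˢ) (∑ᶠ yˢ) D (∑ᶠ (λ i → xˢ i * yˢ i)) ⟩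
  x₀ * y₀ + x₀ * ∑ᶠ yˢ + ∑ᶠ xˢ * y₀ + (D + ∑ᶠ (λ i → xˢ i * yˢ i))
    ≡⟨ cong (x₀ * y₀ + x₀ * ∑ᶠ yˢ + ∑ᶠ xˢ * y₀ +_) (∑<-product n xˢ yˢ) ⟩
  x₀ * y₀ + x₀ * ∑ᶠ yˢ + ∑ᶠ xˢ * y₀ + ∑ᶠ xˢ * ∑ᶠ yˢ
    ≡⟨ lemma′ x₀ y₀ (∑ᶠ xˢ) (∑ᶠ yˢ) ⟩
  (x₀ + ∑ᶠ xˢ) * (y₀ + ∑ᶠ yˢ)
    ≡⟨ cong₂ _*_ (∑ᶠ-suc x) (∑ᶠ-suc y) ⟨
  ∑ᶠ x * ∑ᶠ y ∎
  where
  open ≡-Reasoning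
  h : Fin (suc n) → Fin (suc n) → ℕ
  h i j = ⟦ does (toℕ i <? toℕ j) ⟧ * (x i * y j + x j * y i)
  x₀ = x zero
  y₀ = y zero
  xˢ = x ∘ suc
  yˢ = y ∘ suc
  D = ∑ᶠ (λ i → ∑ᶠ (λ j → ⟦ does (toℕ i <? toℕ j) ⟧ * (xˢ i * yˢ j + xˢ j * yˢ i)))
  row₀ : ∑ᶠ (h zero) ≡ x₀ * ∑ᶠ yˢ + ∑ᶠ xˢ * y₀
  row₀ = begin
    ∑ᶠ (h zero)                                  ≡⟨ ∑ᶠ-suc (h zero) ⟩
    ∑ᶠ (λ j → x₀ * yˢ j + xˢ j * y₀ + 0)         ≡⟨ ∑-cong (allFin n) (λ j → +-identityʳ _) ⟩
    ∑ᶠ (λ j → x₀ * yˢ j + xˢ j * y₀)             ≡⟨ ∑-+ _ _ (allFin n) ⟩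
    ∑ᶠ (λ j → x₀ * yˢ j) + ∑ᶠ (λ j → xˢ j * y₀)
      ≡⟨ cong₂ _+_ (∑-*ˡ x₀ yˢ (allFin n)) (∑-*ʳ y₀ xˢ (allFin n)) ⟩
    x₀ * ∑ᶠ yˢ + ∑ᶠ xˢ * y₀                      ∎
  rows : ∑ᶠ (λ i → ∑ᶠ (h (suc i))) ≡ D
  rows = ∑-cong (allFin n) (λ i → ∑ᶠ-suc (h (suc i)))
  lemma : ∀ a b c d e f → a * d + c * b + e + (a * b + f) ≡ a * b + a * d + c * b + (e + f)
  lemma = solve-∀
  lemma′ : ∀ a b c d → a * b + a * d + c * b + c * d ≡ (a + c) * (b + d)
  lemma′ = solve-∀

∑-pairs : ∀ n (F : Call n → ℕ) →
  ∑ (pairs n) F ≡ ∑ᶠ (λ i → ∑ᶠ (λ j → ⟦ does (toℕ i <? toℕ j) ⟧ * F (i , j)))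
∑-pairs n F = begin
  ∑ (pairs n) F
    ≡⟨ ∑-filter _ F (concatMap (λ i → map (λ j → (i , j)) (allFin n)) (allFin n)) ⟩
  ∑ (concatMap (λ i → map (λ j → (i , j)) (allFin n)) (allFin n)) G
    ≡⟨ ∑-concatMap (λ i → map (λ j → (i , j)) (allFin n)) G (allFin n) ⟩
  ∑ᶠ (λ i → ∑ (map (λ j → (i , j)) (allFin n)) G)
    ≡⟨ ∑-cong (allFin n) (λ i → ∑-map (λ j → (i , j)) G (allFin n)) ⟩
  ∑ᶠ (λ i → ∑ᶠ (λ j → G (i , j))) ∎
  where
  open ≡-Reasoning
  G : Call n → ℕ
  G (i , j) = ⟦ does (toℕ i <? toℕ j) ⟧ * F (i , j)

∑-pairs-product : ∀ n (x y : Fin n → ℕ) →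
  ∑ (pairs n) (λ (i , j) → x i * y j + x j * y i) + ∑ᶠ (λ i → x i * y i) ≡ ∑ᶠ x * ∑ᶠ y
∑-pairs-product n x y =
  trans (cong (_+ ∑ᶠ (λ i → x i * y i)) (∑-pairs n _)) (∑<-product n x y)

pairs-< : ∀ n → All (λ (i , j) → toℕ i < toℕ j) (pairs n)
pairs-< n = all-filter _ (concatMap (λ i → map (λ j → (i , j)) (allFin n)) (allFin n))

2*∣pairs∣ : ∀ n → 2 * length (pairs n) + n ≡ n * n
2*∣pairs∣ n = begin
  2 * length (pairs n) + n
    ≡⟨ cong₂ _+_ (trans (*-comm 2 (length (pairs n))) (sym (∑-const 2 (pairs n)))) (sym (trans (∑ᶠ-const n 1) (*-identityʳ n))) ⟩
  ∑ (pairs n) (λ _ → 2) + ∑ᶠ {n} (λ _ → 1)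
    ≡⟨ ∑-pairs-product n (λ _ → 1) (λ _ → 1) ⟩
  ∑ᶠ {n} (λ _ → 1) * ∑ᶠ {n} (λ _ → 1)
    ≡⟨ cong₂ _*_ eq eq ⟩
  n * n ∎
  where
  open ≡-Reasoning
  eq : ∑ᶠ {n} (λ _ → 1) ≡ n
  eq = trans (∑ᶠ-const n 1) (*-identityʳ n)

-- Knowledge as a backward infection

module _ {n : ℕ} where

  ∑-seqs-suc : ∀ t (f : List (Call n) → ℕ) →
    ∑ (seqs n (suc t)) f ≡ ∑ (pairs n) (λ c → ∑ (seqs n t) (λ σ → f (c ∷ σ)))
  ∑-seqs-suc t f = trans (∑-concatMap (λ c → map (c ∷_) (seqs n t)) f (pairs n))
    (∑-cong (pairs n) (λ c → ∑-map (c ∷_) f (seqs n t)))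

  -- The call in front is the earliest, hence the newest in the backward process; summing over it
  -- innermost is conditioning on the calls that follow it.
  ∑-seqs-suc′ : ∀ t (f : List (Call n) → ℕ) →
    ∑ (seqs n (suc t)) f ≡ ∑ (seqs n t) (λ σ → ∑ (pairs n) (λ c → f (c ∷ σ)))
  ∑-seqs-suc′ t f = trans (∑-seqs-suc t f) (∑-swap (λ c σ → f (c ∷ σ)) (pairs n) (seqs n t))

  ∑-seqs-split : ∀ t u (F : List (Call n) → List (Call n) → ℕ) →
    ∑ (seqs n (t + u)) (λ σ → F (take t σ) (drop t σ)) ≡ ∑ (seqs n t) (λ τ → ∑ (seqs n u) (F τ))
  ∑-seqs-split zero    u F = sym (+-identityʳ _)
  ∑-seqs-split (suc t) u F = begin
    ∑ (seqs n (suc (t + u))) (λ σ → F (take (suc t) σ) (drop (suc t) σ))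
      ≡⟨ ∑-seqs-suc (t + u) _ ⟩
    ∑ (pairs n) (λ c → ∑ (seqs n (t + u)) (λ σ → F (c ∷ take t σ) (drop t σ)))
      ≡⟨ ∑-cong (pairs n) (λ c → ∑-seqs-split t u (λ τ → F (c ∷ τ))) ⟩
    ∑ (pairs n) (λ c → ∑ (seqs n t) (λ τ → ∑ (seqs n u) (F (c ∷ τ))))
      ≡⟨ ∑-seqs-suc t (λ τ → ∑ (seqs n u) (F τ)) ⟨
    ∑ (seqs n (suc t)) (λ τ → ∑ (seqs n u) (F τ)) ∎
    where open ≡-Reasoning

  ∑-seqs-const : ∀ t k → ∑ (seqs n t) (λ _ → k) ≡ length (pairs n) ^ t * k
  ∑-seqs-const zero    k = refl
  ∑-seqs-const (suc t) k = begin
    ∑ (seqs n (suc t)) (λ _ → k)                  ≡⟨ ∑-seqs-suc t (λ _ → k) ⟩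
    ∑ (pairs n) (λ _ → ∑ (seqs n t) (λ _ → k))    ≡⟨ ∑-const _ (pairs n) ⟩
    N * ∑ (seqs n t) (λ _ → k)                    ≡⟨ cong (N *_) (∑-seqs-const t k) ⟩
    N * (N ^ t * k)                               ≡⟨ *-assoc N (N ^ t) k ⟨
    N * N ^ t * k                                 ∎
    where
    open ≡-Reasoning
    N = length (pairs n)

  -- Divided by `length (pairs n) ^ t` this bounds an expectation. Growing potentials use A = 1; the
  -- decaying one uses A = 1 + e to clear its fractional rate.
  supermartingale : ∀ A B (f : List (Call n) → ℕ) →
    (∀ σ → A * ∑ (pairs n) (λ c → f (c ∷ σ)) ≤ B * f σ) →
    ∀ t → A ^ t * ∑ (seqs n t) f ≤ B ^ t * f []
  supermartingale A B f h zero    = ≤-reflexive (cong (1 *_) (+-identityʳ (f [])))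
  supermartingale A B f h (suc t) = begin
    A * A ^ t * ∑ (seqs n (suc t)) f
      ≡⟨ cong (A * A ^ t *_) (∑-seqs-suc′ t f) ⟩
    A * A ^ t * ∑ (seqs n t) (λ σ → ∑ (pairs n) (λ c → f (c ∷ σ)))
      ≡⟨ lemma A (A ^ t) _ ⟩
    A ^ t * (A * ∑ (seqs n t) (λ σ → ∑ (pairs n) (λ c → f (c ∷ σ))))
      ≡⟨ cong (A ^ t *_) (∑-*ˡ A _ (seqs n t)) ⟨
    A ^ t * ∑ (seqs n t) (λ σ → A * ∑ (pairs n) (λ c → f (c ∷ σ)))
      ≤⟨ *-monoʳ-≤ (A ^ t) (∑-mono (seqs n t) h) ⟩
    A ^ t * ∑ (seqs n t) (λ σ → B * f σ)
      ≡⟨ cong (A ^ t *_) (∑-*ˡ B f (seqs n t)) ⟩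
    A ^ t * (B * ∑ (seqs n t) f)
      ≡⟨ lemma′ (A ^ t) B _ ⟩
    B * (A ^ t * ∑ (seqs n t) f)
      ≤⟨ *-monoʳ-≤ B (supermartingale A B f h t) ⟩
    B * (B ^ t * f [])
      ≡⟨ *-assoc B (B ^ t) (f []) ⟨
    B ^ suc t * f [] ∎
    where
    open ≤-Reasoning
    lemma : ∀ a b c → a * b * c ≡ b * (a * c)
    lemma = solve-∀
    lemma′ : ∀ a b c → a * (b * c) ≡ b * (a * c)
    lemma′ = solve-∀

  infect : Call n → (Fin n → Bool) → Fin n → Bool
  infect (i , j) I a = if ⌊ a ≟ᶠ i ⌋ ∨ ⌊ a ≟ᶠ j ⌋ then I i ∨ I j else I a

  -- Read backwards in time, the set of agents whose initial secret ends up at a spreads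
  -- like an infection, so that a single spreading process governs all four quantities.
  reach : List (Call n) → Fin n → Fin n → Bool
  reach []      a = initial a
  reach (c ∷ σ) a = infect c (reach σ a)

  step≡infect : ∀ c (K : Know n) a s → step c K a s ≡ infect c (λ x → K x s) a
  step≡infect (i , j) K a s with ⌊ a ≟ᶠ i ⌋ ∨ ⌊ a ≟ᶠ j ⌋
  ... | true  = refl
  ... | false = refl

  initial-refl : ∀ (a : Fin n) → initial a a ≡ true
  initial-refl a with a ≟ᶠ a
  ... | yes _  = refl
  ... | no a≢a = contradiction refl a≢a

  initial-≡ : ∀ (a s : Fin n) → initial a s ≡ true → a ≡ s
  initial-≡ a s h with a ≟ᶠ s
  ... | yes a≡s = a≡s
  initial-≡ a s () | no _

  infectˡ : ∀ i j I → infect (i , j) I i ≡ I i ∨ I j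
  infectˡ i j I with i ≟ᶠ i
  ... | yes _  = refl
  ... | no i≢i = contradiction refl i≢i

  infectʳ : ∀ i j I → infect (i , j) I j ≡ I i ∨ I j
  infectʳ i j I with j ≟ᶠ i | j ≟ᶠ j
  ... | yes _ | _      = refl
  ... | no _  | yes _  = refl
  ... | no _  | no j≢j = contradiction refl j≢j

  infect-⊇ : ∀ c I a → I a ≡ true → infect c I a ≡ true
  infect-⊇ (i , j) I a h with a ≟ᶠ i | a ≟ᶠ j
  ... | yes refl | _        rewrite h = refl
  ... | no _     | yes refl rewrite h = ∨-zeroʳ (I i)
  ... | no _     | no _     = h

  reach-self : ∀ σ a → reach σ a a ≡ true
  reach-self []      a = initial-refl a
  reach-self (c ∷ σ) a = infect-⊇ c (reach σ a) a (reach-self σ a)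

  -- Duality of a single call: since a call is symmetric, the agent y that passes the secret to x
  -- forwards is also reached from x backwards. The quantifier over J leaves the later calls
  -- arbitrary.
  infect-source : ∀ c I x → infect c I x ≡ true →
    ∃ λ y → I y ≡ true × (∀ J → J x ≡ true → infect c J y ≡ true)
  infect-source (i , j) I x h with x ≟ᶠ i | x ≟ᶠ j
  ... | no _     | no _ = x , h , λ J → infect-⊇ (i , j) J x
  ... | yes refl | _    with I i in eq
  ...   | true  = i , eq , λ J → infect-⊇ (i , j) J i
  ...   | false = j , h , λ J k → trans (infectʳ i j J) (cong (_∨ J j) k)
  infect-source (i , j) I x h | no _ | yes refl with I i in eq
  ...   | true  = i , eq , λ J k → trans (infectˡ i j J) (trans (cong (J i ∨_) k) (∨-zeroʳ (J i)))
  ...   | false = j , h , λ J → infect-⊇ (i , j) J j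

  run⇒reach : ∀ K σ a s → run K σ a s ≡ true → ∃ λ x → reach σ a x ≡ true × K x s ≡ true
  run⇒reach K []      a s h = a , initial-refl a , h
  run⇒reach K (c ∷ σ) a s h
    with x , r , k ← run⇒reach (step c K) σ a s h
    with y , k′ , back ← infect-source c (λ z → K z s) x (trans (sym (step≡infect c K x s)) k)
    = y , back (reach σ a) r , k′

  reach⇒run : ∀ K σ a x s → reach σ a x ≡ true → K x s ≡ true → run K σ a s ≡ true
  reach⇒run K []      a x s r k rewrite initial-≡ a x r = k
  reach⇒run K (c ∷ σ) a x s r k
    with y , r′ , back ← infect-source c (reach σ a) x r
    = reach⇒run (step c K) σ a y s r′ (trans (step≡infect c K y s) (back (λ z → K z s) k))

  run≡reach : ∀ σ a s → run initial σ a s ≡ reach σ a s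
  run≡reach σ a s with run initial σ a s in eq₁ | reach σ a s in eq₂
  ... | true  | true  = refl
  ... | false | false = refl
  ... | true  | false with x , r , k ← run⇒reach initial σ a s eq₁
    with refl ← initial-≡ x s k = trans (sym r) eq₂
  run≡reach σ a s | false | true =
    trans (sym eq₁) (reach⇒run initial σ a s s eq₂ (initial-refl s))

  size cosize : (Fin n → Bool) → ℕ
  size   I = ∑ᶠ (λ a → ⟦ I a ⟧)
  cosize I = ∑ᶠ (λ a → ⟦ not (I a) ⟧)

  flow : (Fin n → Bool) → Call n → ℕ
  flow I (i , j) = ⟦ I i ⟧ * ⟦ not (I j) ⟧ + ⟦ I j ⟧ * ⟦ not (I i) ⟧

  size+cosize : ∀ I → size I + cosize I ≡ n
  size+cosize I = begin
    size I + cosize I                        ≡⟨ ∑-+ _ _ (allFin n) ⟨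
    ∑ᶠ (λ a → ⟦ I a ⟧ + ⟦ not (I a) ⟧)       ≡⟨ ∑-cong (allFin n) (λ a → lemma (I a)) ⟩
    ∑ᶠ {n} (λ _ → 1)                         ≡⟨ ∑ᶠ-const n 1 ⟩
    n * 1                                    ≡⟨ *-identityʳ n ⟩
    n                                        ∎
    where
    open ≡-Reasoning
    lemma : ∀ b → ⟦ b ⟧ + ⟦ not b ⟧ ≡ 1
    lemma true  = refl
    lemma false = refl

  -- Written with δ, the change is linear in the indicators of the two ends of the call, so that a
  -- sum over a can be evaluated by `∑ᶠ-δ`.
  ⟦infect⟧ : ∀ i j I a → ⟦ infect (i , j) I a ⟧
    ≡ ⟦ I a ⟧ + (δ a j * (⟦ I i ⟧ * ⟦ not (I j) ⟧) + δ a i * (⟦ I j ⟧ * ⟦ not (I i) ⟧))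
  ⟦infect⟧ i j I a with a ≟ᶠ i | a ≟ᶠ j
  ... | no _     | no _     = sym (+-identityʳ _)
  ... | yes refl | yes refl with I a
  ...   | true  = refl
  ...   | false = refl
  ⟦infect⟧ i j I a | yes refl | no _ with I a | I j
  ...   | true  | true  = refl
  ...   | true  | false = refl
  ...   | false | true  = refl
  ...   | false | false = refl
  ⟦infect⟧ i j I a | no _ | yes refl with I i | I a
  ...   | true  | true  = refl
  ...   | true  | false = refl
  ...   | false | true  = refl
  ...   | false | false = refl

  size-infect : ∀ c I → size (infect c I) ≡ size I + flow I c
  size-infect (i , j) I = begin
    size (infect (i , j) I)
      ≡⟨ ∑-cong (allFin n) (⟦infect⟧ i j I) ⟩
    ∑ᶠ (λ a → ⟦ I a ⟧ + (δ a j * X + δ a i * Y))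
      ≡⟨ ∑-+ _ _ (allFin n) ⟩
    size I + ∑ᶠ (λ a → δ a j * X + δ a i * Y)
      ≡⟨ cong (size I +_) (∑-+ _ _ (allFin n)) ⟩
    size I + (∑ᶠ (λ a → δ a j * X) + ∑ᶠ (λ a → δ a i * Y))
      ≡⟨ cong (size I +_) (cong₂ _+_ (∑ᶠ-δ j (λ _ → X)) (∑ᶠ-δ i (λ _ → Y))) ⟩
    size I + flow I (i , j) ∎
    where
    open ≡-Reasoning
    X = ⟦ I i ⟧ * ⟦ not (I j) ⟧
    Y = ⟦ I j ⟧ * ⟦ not (I i) ⟧

  cosize-infect : ∀ c I → cosize (infect c I) + flow I c ≡ cosize I
  cosize-infect c I = +-cancelˡ-≡ (size I) _ _ (begin
    size I + (cosize (infect c I) + flow I c)   ≡⟨ lemma (size I) (cosize (infect c I)) (flow I c) ⟩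
    size I + flow I c + cosize (infect c I)     ≡⟨ cong (_+ cosize (infect c I)) (size-infect c I) ⟨
    size (infect c I) + cosize (infect c I)     ≡⟨ size+cosize (infect c I) ⟩
    n                                           ≡⟨ size+cosize I ⟨
    size I + cosize I                           ∎)
    where
    open ≡-Reasoning
    lemma : ∀ a b c → a + (b + c) ≡ a + c + b
    lemma = solve-∀

  ∑-disjoint : ∀ I (y : Fin n → ℕ) → (∀ i → ⟦ I i ⟧ * y i ≡ 0) →
    ∑ (pairs n) (λ (i , j) → ⟦ I i ⟧ * y j + ⟦ I j ⟧ * y i) ≡ size I * ∑ᶠ y
  ∑-disjoint I y h = begin
    S                                        ≡⟨ +-identityʳ S ⟨
    S + 0                                    ≡⟨ cong (S +_) diagonal ⟨
    S + ∑ᶠ (λ i → ⟦ I i ⟧ * y i)             ≡⟨ ∑-pairs-product n (λ i → ⟦ I i ⟧) y ⟩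
    size I * ∑ᶠ y                            ∎
    where
    open ≡-Reasoning
    S = ∑ (pairs n) (λ (i , j) → ⟦ I i ⟧ * y j + ⟦ I j ⟧ * y i)
    diagonal : ∑ᶠ (λ i → ⟦ I i ⟧ * y i) ≡ 0
    diagonal = trans (∑-cong (allFin n) h) (trans (∑ᶠ-const n 0) (*-zeroʳ n))

  ∑-flow : ∀ I → ∑ (pairs n) (flow I) ≡ size I * cosize I
  ∑-flow I = ∑-disjoint I (λ j → ⟦ not (I j) ⟧) (λ i → lemma (I i))
    where
    lemma : ∀ b → ⟦ b ⟧ * ⟦ not b ⟧ ≡ 0
    lemma true  = refl
    lemma false = refl

  -- V is the value of a potential after one call, g its value before, and y j its value
  -- once j joins the infected set I.
  one-call : ∀ I g (y : Fin n → ℕ) (V : Call n → ℕ) →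
    (∀ i → ⟦ I i ⟧ * y i ≡ 0) →
    (∀ i j → V (i , j) + flow I (i , j) * g ≤ g + (⟦ I i ⟧ * y j + ⟦ I j ⟧ * y i)) →
    ∑ (pairs n) V + size I * cosize I * g ≤ length (pairs n) * g + size I * ∑ᶠ y
  one-call I g y V h hV = begin
    ∑ (pairs n) V + size I * cosize I * g
      ≡⟨ cong (λ z → ∑ (pairs n) V + z * g) (∑-flow I) ⟨
    ∑ (pairs n) V + ∑ (pairs n) (flow I) * g
      ≡⟨ cong (∑ (pairs n) V +_) (∑-*ʳ g (flow I) (pairs n)) ⟨
    ∑ (pairs n) V + ∑ (pairs n) (λ c → flow I c * g)
      ≡⟨ ∑-+ V _ (pairs n) ⟨
    ∑ (pairs n) (λ c → V c + flow I c * g)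
      ≤⟨ ∑-mono (pairs n) (λ (i , j) → hV i j) ⟩
    ∑ (pairs n) (λ (i , j) → g + (⟦ I i ⟧ * y j + ⟦ I j ⟧ * y i))
      ≡⟨ ∑-+ (λ _ → g) _ (pairs n) ⟩
    ∑ (pairs n) (λ _ → g) + ∑ (pairs n) (λ (i , j) → ⟦ I i ⟧ * y j + ⟦ I j ⟧ * y i)
      ≡⟨ cong₂ _+_ (∑-const g (pairs n)) (∑-disjoint I y h) ⟩
    length (pairs n) * g + size I * ∑ᶠ y ∎
    where open ≤-Reasoning

-- Potentials

δ-sym : ∀ {n} (a i : Fin n) → δ a i ≡ δ i a
δ-sym a i with a ≟ᶠ i | i ≟ᶠ a
... | yes _    | yes _   = refl
... | no _     | no _    = refl
... | yes refl | no i≢i  = contradiction refl i≢i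
... | no a≢a   | yes refl = contradiction refl a≢a

⟦_⟧≤1 : ∀ b → ⟦ b ⟧ ≤ 1
⟦ true ⟧≤1  = ≤-refl
⟦ false ⟧≤1 = z≤n

-- Clears the denominators q 0 , … , q n: H u stands for D / q u.
reciprocals : (q : ℕ → ℕ) → (∀ u → NonZero (q u)) → ∀ n →
  Σ ℕ λ D → NonZero D × Σ (ℕ → ℕ) λ H → ∀ u → u ≤ n → H u * q u ≡ D
reciprocals q q≢0 zero    = q 0 , q≢0 0 , (λ _ → 1) , λ { zero z≤n → *-identityˡ (q 0) }
reciprocals q q≢0 (suc n) with D , D≢0 , H , h ← reciprocals q q≢0 n =
  D * q (suc n) , m*n≢0 D (q (suc n)) {{D≢0}} {{q≢0 (suc n)}} , H′ , h′
  where
  H′ : ℕ → ℕ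
  H′ u with u ≤? n
  ... | yes _ = H u * q (suc n)
  ... | no  _ = D
  h′ : ∀ u → u ≤ suc n → H′ u * q u ≡ D * q (suc n)
  h′ u u≤1+n with u ≤? n
  ... | yes u≤n = trans (lemma (H u) (q (suc n)) (q u)) (cong (_* q (suc n)) (h u u≤n))
    where
    lemma : ∀ a b c → a * b * c ≡ a * c * b
    lemma = solve-∀
  ... | no  u≰n = cong (λ v → D * q v) (≤-antisym u≤1+n (≰⇒> u≰n))

-- The rising factorial m (m + 1) ... (m + s - 1): a stand-in for m^s whose consecutive values have
-- the exact ratio (m + s) / m.
rising : ℕ → ℕ → ℕ
rising m zero    = 1
rising m (suc s) = m * rising (suc m) s

rising-shift : ∀ m s → m * rising (suc m) s ≡ (m + s) * rising m s
rising-shift m zero    = cong (_* 1) (sym (+-identityʳ m))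
rising-shift m (suc s) = begin
  m * (suc m * rising (suc (suc m)) s)     ≡⟨ cong (m *_) (rising-shift (suc m) s) ⟩
  m * ((suc m + s) * rising (suc m) s)     ≡⟨ lemma m s (rising (suc m) s) ⟩
  (m + suc s) * (m * rising (suc m) s)     ∎
  where
  open ≡-Reasoning
  lemma : ∀ m s r → m * ((1 + m + s) * r) ≡ (m + (1 + s)) * (m * r)
  lemma = solve-∀

rising-nonZero : ∀ m s → NonZero (rising (suc m) s)
rising-nonZero m zero    = _
rising-nonZero m (suc s) = m*n≢0 (suc m) (rising (suc (suc m)) s) {{_}} {{rising-nonZero (suc m) s}}

^≤rising : ∀ m s → m ^ s ≤ rising m s
^≤rising m zero    = ≤-refl
^≤rising m (suc s) = *-monoʳ-≤ m (≤-trans (^-monoˡ-≤ s (n≤1+n m)) (^≤rising (suc m) s))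

rising-1 : ∀ s → rising 1 s ≡ fact s
rising-1 zero    = refl
rising-1 (suc s) = trans (rising-shift 1 s) (cong (suc s *_) (rising-1 s))

-- f is 1 exactly when one end of the call is informed. In that case the old value cancels and only
-- the new value at size m + 1 is left; this supplies the pointwise hypothesis of `one-call`.
change-of-size : ∀ (φ : ℕ → ℕ → ℕ) b c {m u m′ u′} → let f = ⟦ b ⟧ * ⟦ not c ⟧ + ⟦ c ⟧ * ⟦ not b ⟧ in
  m′ ≡ m + f → u′ + f ≡ u →
  φ m′ u′ + f * φ m u
    ≤ φ m u + (⟦ b ⟧ * (⟦ not c ⟧ * φ (suc m) (pred u)) + ⟦ c ⟧ * (⟦ not b ⟧ * φ (suc m) (pred u)))
change-of-size φ true  true  {m} {u′ = u} refl refl rewrite +-identityʳ m | +-identityʳ u = ≤-refl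
change-of-size φ false false {m} {u′ = u} refl refl rewrite +-identityʳ m | +-identityʳ u = ≤-refl
change-of-size φ true  false {m} {u′ = u} refl refl rewrite +-comm m 1 | +-comm u 1 =
  ≤-reflexive (lemma (φ (suc m) u) (φ m (suc u)))
  where
  lemma : ∀ a b → a + (b + 0) ≡ b + (a + 0 + 0 + 0)
  lemma = solve-∀
change-of-size φ false true  {m} {u′ = u} refl refl rewrite +-comm m 1 | +-comm u 1 =
  ≤-reflexive (lemma (φ (suc m) u) (φ m (suc u)))
  where
  lemma : ∀ a b → a + (b + 0) ≡ b + (a + 0 + 0)
  lemma = solve-∀

module _ {n : ℕ} where

  private
    N = length (pairs n)

  size-initial : ∀ (a : Fin n) → size (initial a) ≡ 1
  size-initial a = trans (∑-cong (allFin n) (λ x → δ-sym a x)) (∑ᶠ-δ₁ a)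

  size-reach>0 : ∀ σ (a : Fin n) → 1 ≤ size (reach σ a)
  size-reach>0 σ a = begin
    1                   ≡⟨ cong ⟦_⟧ (reach-self σ a) ⟨
    ⟦ reach σ a a ⟧     ≤⟨ term≤∑ᶠ (λ x → ⟦ reach σ a x ⟧) a ⟩
    size (reach σ a)    ∎
    where open ≤-Reasoning

  size≤n : ∀ (I : Fin n → Bool) → size I ≤ n
  size≤n I = ≤-trans (m≤m+n _ _) (≤-reflexive (size+cosize I))

  cosize≤n : ∀ (I : Fin n → Bool) → cosize I ≤ n
  cosize≤n I = ≤-trans (m≤n+m _ (size I)) (≤-reflexive (size+cosize I))

  ∑-size-infect : ∀ I → ∑ (pairs n) (λ c → size (infect c I)) ≤ (N + n) * size I
  ∑-size-infect I = begin
    ∑ (pairs n) (λ c → size (infect c I))              ≡⟨ ∑-cong (pairs n) (λ c → size-infect c I) ⟩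
    ∑ (pairs n) (λ c → size I + flow I c)              ≡⟨ ∑-+ (λ _ → size I) (flow I) (pairs n) ⟩
    ∑ (pairs n) (λ _ → size I) + ∑ (pairs n) (flow I)
      ≡⟨ cong₂ _+_ (∑-const (size I) (pairs n)) (∑-flow I) ⟩
    N * size I + size I * cosize I
      ≤⟨ +-monoʳ-≤ (N * size I) (*-monoʳ-≤ (size I) (cosize≤n I)) ⟩
    N * size I + size I * n                            ≡⟨ lemma N (size I) n ⟩
    (N + n) * size I                                   ∎
    where
    open ≤-Reasoning
    lemma : ∀ a b c → a * b + b * c ≡ (a + c) * b
    lemma = solve-∀

  ∑-infect : ∀ I a → ∑ (pairs n) (λ c → ⟦ infect c I a ⟧) ≤ N * ⟦ I a ⟧ + size I
  ∑-infect I a = begin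
    ∑ (pairs n) (λ c → ⟦ infect c I a ⟧)
      ≤⟨ ∑-mono (pairs n) (λ (i , j) → pointwise i j) ⟩
    ∑ (pairs n) (λ (i , j) → ⟦ I a ⟧ + (⟦ I i ⟧ * δ a j + ⟦ I j ⟧ * δ a i))
      ≡⟨ ∑-+ (λ _ → ⟦ I a ⟧) _ (pairs n) ⟩
    ∑ (pairs n) (λ _ → ⟦ I a ⟧) + ∑ (pairs n) (λ (i , j) → ⟦ I i ⟧ * δ a j + ⟦ I j ⟧ * δ a i)
      ≤⟨ +-mono-≤ (≤-reflexive (∑-const ⟦ I a ⟧ (pairs n))) (m≤m+n _ _) ⟩
    N * ⟦ I a ⟧ + (∑ (pairs n) (λ (i , j) → ⟦ I i ⟧ * δ a j + ⟦ I j ⟧ * δ a i) + ∑ᶠ (λ i → ⟦ I i ⟧ * δ a i))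
      ≡⟨ cong (N * ⟦ I a ⟧ +_) (∑-pairs-product n (λ i → ⟦ I i ⟧) (δ a)) ⟩
    N * ⟦ I a ⟧ + size I * size (initial a)
      ≡⟨ cong (λ z → N * ⟦ I a ⟧ + size I * z) (size-initial a) ⟩
    N * ⟦ I a ⟧ + size I * 1
      ≡⟨ cong (N * ⟦ I a ⟧ +_) (*-identityʳ (size I)) ⟩
    N * ⟦ I a ⟧ + size I ∎
    where
    open ≤-Reasoning
    bound : ∀ d b c → d * (⟦ b ⟧ * ⟦ not c ⟧) ≤ ⟦ b ⟧ * d
    bound d b c = begin
      d * (⟦ b ⟧ * ⟦ not c ⟧)    ≤⟨ *-monoʳ-≤ d (*-monoʳ-≤ ⟦ b ⟧ ⟦ not c ⟧≤1) ⟩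
      d * (⟦ b ⟧ * 1)            ≡⟨ cong (d *_) (*-identityʳ ⟦ b ⟧) ⟩
      d * ⟦ b ⟧                  ≡⟨ *-comm d ⟦ b ⟧ ⟩
      ⟦ b ⟧ * d                  ∎
    pointwise : ∀ i j → ⟦ infect (i , j) I a ⟧ ≤ ⟦ I a ⟧ + (⟦ I i ⟧ * δ a j + ⟦ I j ⟧ * δ a i)
    pointwise i j = begin
      ⟦ infect (i , j) I a ⟧
        ≡⟨ ⟦infect⟧ i j I a ⟩
      ⟦ I a ⟧ + (δ a j * (⟦ I i ⟧ * ⟦ not (I j) ⟧) + δ a i * (⟦ I j ⟧ * ⟦ not (I i) ⟧))
        ≤⟨ +-monoʳ-≤ ⟦ I a ⟧ (+-mono-≤ (bound (δ a j) (I i) (I j)) (bound (δ a i) (I j) (I i))) ⟩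
      ⟦ I a ⟧ + (⟦ I i ⟧ * δ a j + ⟦ I j ⟧ * δ a i) ∎

  -- The mean infected size is at most (1 + n/N)^t, and b is newly informed with probability at most
  -- size / N. Both terms of the recursion then carry (N + n)^t, with weights N and n, and add up to
  -- the next power. The count starts at 0 because a ≢ b.
  count-reach-≤ : ∀ {a b : Fin n} → a ≢ b → ∀ t →
    n * ∑ (seqs n t) (λ σ → ⟦ reach σ a b ⟧) ≤ (N + n) ^ t
  count-reach-≤ {a} {b} a≢b zero with a ≟ᶠ b
  ... | yes a≡b = contradiction a≡b a≢b
  ... | no _    = ≤-trans (≤-reflexive (*-zeroʳ n)) z≤n
  count-reach-≤ {a} {b} a≢b (suc t) = begin
    n * ∑ (seqs n (suc t)) (λ σ → ⟦ reach σ a b ⟧)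
      ≡⟨ cong (n *_) (∑-seqs-suc′ t (λ σ → ⟦ reach σ a b ⟧)) ⟩
    n * ∑ (seqs n t) (λ σ → ∑ (pairs n) (λ c → ⟦ infect c (reach σ a) b ⟧))
      ≤⟨ *-monoʳ-≤ n (∑-mono (seqs n t) (λ σ → ∑-infect (reach σ a) b)) ⟩
    n * ∑ (seqs n t) (λ σ → N * ⟦ reach σ a b ⟧ + size (reach σ a))
      ≡⟨ cong (n *_) (trans (∑-+ _ _ (seqs n t)) (cong (_+ S) (∑-*ˡ N _ (seqs n t)))) ⟩
    n * (N * Z + S)
      ≡⟨ lemma n N Z S ⟩
    N * (n * Z) + n * (1 * S)
      ≤⟨ +-mono-≤ (*-monoʳ-≤ N (count-reach-≤ a≢b t)) (*-monoʳ-≤ n sizes) ⟩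
    N * (N + n) ^ t + n * (N + n) ^ t
      ≡⟨ *-distribʳ-+ ((N + n) ^ t) N n ⟨
    (N + n) ^ suc t ∎
    where
    open ≤-Reasoning
    Z = ∑ (seqs n t) (λ σ → ⟦ reach σ a b ⟧)
    S = ∑ (seqs n t) (λ σ → size (reach σ a))
    sizes : 1 * S ≤ (N + n) ^ t
    sizes = begin
      1 * S                               ≡⟨ cong (_* S) (^-zeroˡ t) ⟨
      1 ^ t * S                           ≤⟨ supermartingale 1 (N + n) (λ σ → size (reach σ a))
                                               (λ σ → ≤-trans (≤-reflexive (*-identityˡ _)) (∑-size-infect (reach σ a))) t ⟩
      (N + n) ^ t * size (initial a)      ≡⟨ cong ((N + n) ^ t *_) (size-initial a) ⟩
      (N + n) ^ t * 1                     ≡⟨ *-identityʳ _ ⟩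
      (N + n) ^ t                         ∎
    lemma : ∀ a b c d → a * (b * c + d) ≡ b * (a * c) + a * (1 * d)
    lemma = solve-∀

  all-true : ∀ (p : Fin n → Bool) → all p (allFin n) ≡ true → ∀ x → p x ≡ true
  all-true p h x = Equivalence.to T-≡
    (All.lookup (all⁺ p (allFin n) (Equivalence.from T-≡ h)) (∈-allFin x))

  -- The potential rises by the factor (m + s)(u + s) / m u when the size grows from m to
  -- m + 1 (u = n - m), which offsets the probability m u / N of that event.
  module FastSpread (s : ℕ) where

    private
      recip = reciprocals (λ u → rising (suc u) s) (λ u → rising-nonZero u s) n
      D = proj₁ recip
      D≢0 = proj₁ (proj₂ recip)
      H = proj₁ (proj₂ (proj₂ recip))
      H-recip : ∀ u → u ≤ n → H u * rising (suc u) s ≡ D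
      H-recip = proj₂ (proj₂ (proj₂ recip))

    H-suc : ∀ u → suc u ≤ n → suc u * H u ≡ (suc u + s) * H (suc u)
    H-suc u u<n = *-cancelʳ-≡ _ _ (rising (suc u) s) {{rising-nonZero u s}} (begin
      suc u * H u * rising (suc u) s                        ≡⟨ *-assoc (suc u) (H u) _ ⟩
      suc u * (H u * rising (suc u) s)                      ≡⟨ cong (suc u *_) (H-recip u (<⇒≤ u<n)) ⟩
      suc u * D                                             ≡⟨ cong (suc u *_) (H-recip (suc u) u<n) ⟨
      suc u * (H (suc u) * rising (suc (suc u)) s)          ≡⟨ lemma (suc u) (H (suc u)) _ ⟩
      H (suc u) * (suc u * rising (suc (suc u)) s)          ≡⟨ cong (H (suc u) *_) (rising-shift (suc u) s) ⟩
      H (suc u) * ((suc u + s) * rising (suc u) s)          ≡⟨ lemma′ (H (suc u)) (suc u + s) _ ⟩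
      (suc u + s) * H (suc u) * rising (suc u) s            ∎)
      where
      open ≡-Reasoning
      lemma : ∀ a b c → a * (b * c) ≡ b * (a * c)
      lemma = solve-∀
      lemma′ : ∀ a b c → a * (b * c) ≡ b * a * c
      lemma′ = solve-∀

    ψ : ℕ → ℕ → ℕ
    ψ m u = rising m s * H u

    ψ-grow : ∀ m u → u ≤ n → m * (u * ψ (suc m) (pred u)) ≤ (m + s) * (u + s) * ψ m u
    ψ-grow m zero    _   = ≤-trans (≤-reflexive (*-zeroʳ m)) z≤n
    ψ-grow m (suc u) u<n = ≤-reflexive (begin
      m * (suc u * (rising (suc m) s * H u))                    ≡⟨ lemma m (suc u) (rising (suc m) s) (H u) ⟩
      m * rising (suc m) s * (suc u * H u)                      ≡⟨ cong₂ _*_ (rising-shift m s) (H-suc u u<n) ⟩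
      (m + s) * rising m s * ((suc u + s) * H (suc u))          ≡⟨ lemma′ (m + s) (rising m s) (suc u + s) _ ⟩
      (m + s) * (suc u + s) * (rising m s * H (suc u))          ∎)
      where
      open ≡-Reasoning
      lemma : ∀ a b c d → a * (b * (c * d)) ≡ a * c * (b * d)
      lemma = solve-∀
      lemma′ : ∀ a b c d → a * b * (c * d) ≡ a * c * (b * d)
      lemma′ = solve-∀

    Ψ : (Fin n → Bool) → ℕ
    Ψ I = ψ (size I) (cosize I)

    Ψ-step : ∀ I → ∑ (pairs n) (λ c → Ψ (infect c I)) ≤ (N + s * (n + s)) * Ψ I
    Ψ-step I = +-cancelʳ-≤ (m * u * Ψ I) _ _ (begin
      ∑ (pairs n) (λ c → Ψ (infect c I)) + m * u * Ψ I
        ≤⟨ one-call I (Ψ I) y (λ c → Ψ (infect c I)) disjoint pointwise ⟩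
      N * Ψ I + m * ∑ᶠ y
        ≡⟨ cong (λ z → N * Ψ I + m * z) (∑-*ʳ (ψ (suc m) (pred u)) (λ j → ⟦ not (I j) ⟧) (allFin n)) ⟩
      N * Ψ I + m * (u * ψ (suc m) (pred u))
        ≤⟨ +-monoʳ-≤ (N * Ψ I) (ψ-grow m u (cosize≤n I)) ⟩
      N * Ψ I + (m + s) * (u + s) * Ψ I
        ≡⟨ lemma N (Ψ I) m u s ⟩
      (N + s * (m + u + s)) * Ψ I + m * u * Ψ I
        ≡⟨ cong (λ z → (N + s * (z + s)) * Ψ I + m * u * Ψ I) (size+cosize I) ⟩
      (N + s * (n + s)) * Ψ I + m * u * Ψ I ∎)
      where
      open ≤-Reasoning
      m = size I
      u = cosize I
      y : Fin n → ℕ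
      y j = ⟦ not (I j) ⟧ * ψ (suc m) (pred u)
      disjoint : ∀ i → ⟦ I i ⟧ * y i ≡ 0
      disjoint i with I i
      ... | true  = refl
      ... | false = refl
      pointwise : ∀ i j → Ψ (infect (i , j) I) + flow I (i , j) * Ψ I
        ≤ Ψ I + (⟦ I i ⟧ * y j + ⟦ I j ⟧ * y i)
      pointwise i j = change-of-size ψ (I i) (I j) (size-infect (i , j) I) (cosize-infect (i , j) I)
      lemma : ∀ N g m u s → N * g + (m + s) * (u + s) * g ≡ (N + s * (m + u + s)) * g + m * u * g
      lemma = solve-∀

    private
      B = N + s * (n + s)

    Ψ-full : ∀ I → (∀ x → I x ≡ true) → Ψ I ≡ rising n s * H 0
    Ψ-full I h = cong₂ ψ
      (trans (∑-cong (allFin n) (λ x → cong ⟦_⟧ (h x))) (trans (∑ᶠ-const n 1) (*-identityʳ n)))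
      (trans (∑-cong (allFin n) (λ x → cong (λ b → ⟦ not b ⟧) (h x))) (trans (∑ᶠ-const n 0) (*-zeroʳ n)))

    Ψ-expert : ∀ a σ → ⟦ expert a (run initial σ) ⟧ * (rising n s * H 0) ≤ Ψ (reach σ a)
    Ψ-expert a σ with expert a (run initial σ) in eq
    ... | false = z≤n
    ... | true  = ≤-reflexive (trans (*-identityˡ _) (sym (Ψ-full (reach σ a)
            (λ x → trans (sym (run≡reach σ a x)) (all-true (run initial σ a) eq x)))))

    Ψ-initial : ∀ a → Ψ (initial a) * rising n s ≡ fact s * D
    Ψ-initial a = begin
      ψ (size (initial a)) u * rising n s       ≡⟨ cong (λ m → ψ m u * rising n s) (size-initial a) ⟩
      rising 1 s * H u * rising n s             ≡⟨ cong₂ (λ f m → f * H u * rising m s) (rising-1 s) (sym 1+u≡n) ⟩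
      fact s * H u * rising (suc u) s           ≡⟨ *-assoc (fact s) (H u) _ ⟩
      fact s * (H u * rising (suc u) s)         ≡⟨ cong (fact s *_) (H-recip u (cosize≤n (initial a))) ⟩
      fact s * D                                ∎
      where
      open ≡-Reasoning
      u = cosize (initial a)
      1+u≡n : suc u ≡ n
      1+u≡n = trans (cong (_+ u) (sym (size-initial a))) (size+cosize (initial a))

    -- Markov's inequality for Ψ: its value is about D n^s / s! on the full set and D s! / n^s at
    -- the start, and the quotient of the two is n^(2s) / (s!)².
    count-expert-≤ : ∀ a t → let E = ∑ (seqs n t) (λ σ → ⟦ expert a (run initial σ) ⟧) in
      E * n ^ (s + s) ≤ B ^ t * (fact s * fact s)
    count-expert-≤ a t = *-cancelʳ-≤ _ _ D {{D≢0}} (begin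
      E * n ^ (s + s) * D
        ≡⟨ cong (λ z → E * z * D) (^-distribˡ-+-* n s s) ⟩
      E * (n ^ s * n ^ s) * D
        ≤⟨ *-monoˡ-≤ D (*-monoʳ-≤ E (*-mono-≤ (^≤rising n s) (^≤rising n s))) ⟩
      E * (R * R) * D
        ≡⟨ cong (E * (R * R) *_) (trans (sym (H-recip 0 z≤n)) (cong (H 0 *_) (rising-1 s))) ⟩
      E * (R * R) * (H 0 * fact s)
        ≡⟨ lemma₁ E R (H 0) (fact s) ⟩
      1 * (E * (R * H 0)) * (R * fact s)
        ≡⟨ cong₂ (λ x y → x * y * (R * fact s)) (sym (^-zeroˡ t)) (sym (∑-*ʳ (R * H 0) _ (seqs n t))) ⟩
      1 ^ t * ∑ (seqs n t) (λ σ → ⟦ expert a (run initial σ) ⟧ * (R * H 0)) * (R * fact s)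
        ≤⟨ *-monoˡ-≤ (R * fact s) (*-monoʳ-≤ (1 ^ t) (∑-mono (seqs n t) (Ψ-expert a))) ⟩
      1 ^ t * ∑ (seqs n t) (λ σ → Ψ (reach σ a)) * (R * fact s)
        ≤⟨ *-monoˡ-≤ (R * fact s) (supermartingale 1 B (λ σ → Ψ (reach σ a))
             (λ σ → ≤-trans (≤-reflexive (*-identityˡ _)) (Ψ-step (reach σ a))) t) ⟩
      B ^ t * Ψ (initial a) * (R * fact s)
        ≡⟨ lemma₂ (B ^ t) (Ψ (initial a)) R (fact s) ⟩
      B ^ t * (Ψ (initial a) * R * fact s)
        ≡⟨ cong (λ z → B ^ t * (z * fact s)) (Ψ-initial a) ⟩
      B ^ t * (fact s * D * fact s)
        ≡⟨ lemma₃ (B ^ t) (fact s) D ⟩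
      B ^ t * (fact s * fact s) * D ∎)
      where
      open ≤-Reasoning
      E = ∑ (seqs n t) (λ σ → ⟦ expert a (run initial σ) ⟧)
      R = rising n s
      lemma₁ : ∀ e r h f → e * (r * r) * (h * f) ≡ 1 * (e * (r * h)) * (r * f)
      lemma₁ = solve-∀
      lemma₂ : ∀ b x r f → b * x * (r * f) ≡ b * (x * r * f)
      lemma₂ = solve-∀
      lemma₃ : ∀ b f d → b * (f * d * f) ≡ b * (f * f) * d
      lemma₃ = solve-∀

-- With ε = 1/e, the potential is [s uninformed] / (m - 1 + ε), m the number of informed agents.
module SlowSpread {n n′ : ℕ} (n≡1+n′ : n ≡ suc n′)
  (e B : ℕ) (B-def : B + n′ * e ≡ suc e * length (pairs n)) where

  private
    N = length (pairs n)
    recip = reciprocals (λ m → suc (e * m)) (λ _ → _) n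
    W = proj₁ recip
    W≢0 = proj₁ (proj₂ recip)
    v = proj₁ (proj₂ (proj₂ recip))
    v-recip : ∀ m → m ≤ n → v m * suc (e * m) ≡ W
    v-recip = proj₂ (proj₂ (proj₂ recip))

  -- Up to scaling this is 1 / (m - 1 + 1/e) at size m. The value at size 0 is a default: an
  -- infected set contains its source.
  w : ℕ → ℕ
  w zero    = 0
  w (suc m) = v m

  -- Here l counts the uninformed agents other than s. Calls that inform s kill the potential, and
  -- calls that inform one of the l others lower it; together they remove a relative amount of at
  -- least n′ / (N (1 + ε)) per call, since e / (e + 1) = 1 / (1 + ε).
  w-drop : ∀ m l → suc m + suc l ≡ n →
    suc e * (suc m * l * v (suc m)) + n′ * e * v m ≤ suc e * (suc m * suc l * v m)
  w-drop m l eq = *-cancelʳ-≤ _ _ (suc (e * suc m)) (begin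
    (suc e * (suc m * l * v (suc m)) + n′ * e * v m) * suc (e * suc m)
      ≡⟨ lemma₁ e m l (v (suc m)) n′ (v m) ⟩
    suc e * (suc m * l) * (v (suc m) * suc (e * suc m)) + n′ * e * v m * suc (e * suc m)
      ≡⟨ cong (λ z → suc e * (suc m * l) * z + n′ * e * v m * suc (e * suc m))
           (trans (v-recip (suc m) m<n) (sym (v-recip m (<⇒≤ m<n)))) ⟩
    suc e * (suc m * l) * (v m * suc (e * m)) + n′ * e * v m * suc (e * suc m)
      ≡⟨ cong (λ z → suc e * (suc m * l) * (v m * suc (e * m)) + z * e * v m * suc (e * suc m)) n′≡ ⟩
    suc e * (suc m * l) * (v m * suc (e * m)) + (suc m + l) * e * v m * suc (e * suc m)
      -- The added term is the exact difference of the two sides.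
      ≤⟨ m≤m+n _ (v m * (suc m * (e * suc m + 1) + e * l * m)) ⟩
    suc e * (suc m * l) * (v m * suc (e * m)) + (suc m + l) * e * v m * suc (e * suc m)
      + v m * (suc m * (e * suc m + 1) + e * l * m)
      ≡⟨ lemma₂ e m l (v m) ⟩
    suc e * (suc m * suc l * v m) * suc (e * suc m) ∎)
    where
    open ≤-Reasoning
    n′≡ : n′ ≡ suc m + l
    n′≡ = suc-injective (trans (sym n≡1+n′) (trans (sym eq) (+-suc (suc m) l)))
    m<n : suc m ≤ n
    m<n = ≤-trans (m≤m+n (suc m) (suc l)) (≤-reflexive eq)
    lemma₁ : ∀ e m l x n′ y → ((1 + e) * ((1 + m) * l * x) + n′ * e * y) * (1 + e * (1 + m))
      ≡ (1 + e) * ((1 + m) * l) * (x * (1 + e * (1 + m))) + n′ * e * y * (1 + e * (1 + m))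
    lemma₁ = solve-∀
    lemma₂ : ∀ e m l y → (1 + e) * ((1 + m) * l) * (y * (1 + e * m)) + ((1 + m) + l) * e * y * (1 + e * (1 + m))
      + y * ((1 + m) * (e * (1 + m) + 1) + e * l * m)
      ≡ (1 + e) * ((1 + m) * (1 + l) * y) * (1 + e * (1 + m))
    lemma₂ = solve-∀

  Φ : Fin n → (Fin n → Bool) → ℕ
  Φ s I = ⟦ not (I s) ⟧ * w (size I)

  Φ-step-informed : ∀ s I → I s ≡ true → suc e * ∑ (pairs n) (λ c → Φ s (infect c I)) ≤ B * Φ s I
  Φ-step-informed s I Is = ≤-trans (≤-reflexive (trans (cong (suc e *_) vanish) (*-zeroʳ (suc e)))) z≤n
    where
    vanish : ∑ (pairs n) (λ c → Φ s (infect c I)) ≡ 0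
    vanish = trans (∑-cong (pairs n) (λ c → cong (λ b → ⟦ not b ⟧ * w (size (infect c I))) (infect-⊇ c I s Is)))
      (trans (∑-const 0 (pairs n)) (*-zeroʳ N))

  -- k is the indicator that s is still uninformed after the call, kⱼ and kᵢ that j and i differ
  -- from s. If the call informs somebody, s stays uninformed only when it is not the newcomer;
  -- otherwise k ≤ 1 suffices.
  Φ-change : ∀ b c {m m′} k kⱼ kᵢ → let f = ⟦ b ⟧ * ⟦ not c ⟧ + ⟦ c ⟧ * ⟦ not b ⟧ in
    m′ ≡ m + f → k ≤ 1 → (b ≡ true → k ≤ kⱼ) → (c ≡ true → k ≤ kᵢ) →
    k * w m′ + f * w m
      ≤ w m + (⟦ b ⟧ * (⟦ not c ⟧ * kⱼ * w (suc m)) + ⟦ c ⟧ * (⟦ not b ⟧ * kᵢ * w (suc m)))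
  Φ-change true  true  {m} k kⱼ kᵢ refl k≤1 _ _ rewrite +-identityʳ m =
    +-monoˡ-≤ 0 (≤-trans (*-monoˡ-≤ (w m) k≤1) (≤-reflexive (*-identityˡ (w m))))
  Φ-change false false {m} k kⱼ kᵢ refl k≤1 _ _ rewrite +-identityʳ m =
    +-monoˡ-≤ 0 (≤-trans (*-monoˡ-≤ (w m) k≤1) (≤-reflexive (*-identityˡ (w m))))
  Φ-change true  false {m} k kⱼ kᵢ refl k≤1 hⱼ _ rewrite +-comm m 1 =
    ≤-trans (+-monoˡ-≤ (1 * w m) (*-monoˡ-≤ (v m) (hⱼ refl))) (≤-reflexive (lemma kⱼ (v m) (w m)))
    where
    lemma : ∀ k v w → k * v + (1 * w) ≡ w + (1 * (1 * k * v) + 0)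
    lemma = solve-∀
  Φ-change false true  {m} k kⱼ kᵢ refl k≤1 _ hᵢ rewrite +-comm m 1 =
    ≤-trans (+-monoˡ-≤ (1 * w m) (*-monoˡ-≤ (v m) (hᵢ refl))) (≤-reflexive (lemma kᵢ (v m) (w m)))
    where
    lemma : ∀ k v w → k * v + (1 * w) ≡ w + (0 + 1 * (1 * k * v))
    lemma = solve-∀

  infect-stays-outˡ : ∀ i j I s → I j ≡ true → ⟦ not (infect (i , j) I s) ⟧ ≤ ⟦ not ⌊ i ≟ᶠ s ⌋ ⟧
  infect-stays-outˡ i j I s Ij with i ≟ᶠ s
  ... | no _     = ⟦ not (infect {n} (i , j) I s) ⟧≤1
  ... | yes refl rewrite infectˡ i j I | Ij | ∨-zeroʳ (I i) = z≤n

  infect-stays-outʳ : ∀ i j I s → I i ≡ true → ⟦ not (infect (i , j) I s) ⟧ ≤ ⟦ not ⌊ j ≟ᶠ s ⌋ ⟧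
  infect-stays-outʳ i j I s Ii with j ≟ᶠ s
  ... | no _     = ⟦ not (infect {n} (i , j) I s) ⟧≤1
  ... | yes refl rewrite infectʳ i j I | Ii = z≤n

  Φ-step-uninformed : ∀ s I → I s ≡ false → suc e * ∑ (pairs n) (λ c → Φ s (infect c I)) ≤ B * Φ s I
  Φ-step-uninformed s I Is = ≤-trans (bound (size I) refl) (≤-reflexive (cong (B *_)
    (sym (trans (cong (λ b → ⟦ not b ⟧ * w (size I)) Is) (*-identityˡ (w (size I)))))))
    where
    l = ∑ᶠ (λ j → ⟦ not (I j) ⟧ * ⟦ not ⌊ j ≟ᶠ s ⌋ ⟧)
    l-suc : suc l ≡ cosize I
    l-suc = begin
      suc l
        ≡⟨ cong (λ b → ⟦ not b ⟧ + l) Is ⟨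
      ⟦ not (I s) ⟧ + l
        ≡⟨ cong (_+ l) (∑ᶠ-δ s (λ j → ⟦ not (I j) ⟧)) ⟨
      ∑ᶠ (λ j → δ j s * ⟦ not (I j) ⟧) + l
        ≡⟨ ∑-+ _ _ (allFin n) ⟨
      ∑ᶠ (λ j → δ j s * ⟦ not (I j) ⟧ + ⟦ not (I j) ⟧ * ⟦ not ⌊ j ≟ᶠ s ⌋ ⟧)
        ≡⟨ ∑-cong (allFin n) (λ j → split ⌊ j ≟ᶠ s ⌋ (I j)) ⟩
      cosize I ∎
      where
      open ≡-Reasoning
      split : ∀ b c → ⟦ b ⟧ * ⟦ not c ⟧ + ⟦ not c ⟧ * ⟦ not b ⟧ ≡ ⟦ not c ⟧
      split true  true  = refl
      split true  false = refl
      split false true  = refl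
      split false false = refl
    y : Fin n → ℕ
    y j = ⟦ not (I j) ⟧ * ⟦ not ⌊ j ≟ᶠ s ⌋ ⟧ * w (suc (size I))
    disjoint : ∀ i → ⟦ I i ⟧ * y i ≡ 0
    disjoint i with I i
    ... | true  = refl
    ... | false = refl
    pointwise : ∀ i j → Φ s (infect (i , j) I) + flow I (i , j) * w (size I)
      ≤ w (size I) + (⟦ I i ⟧ * y j + ⟦ I j ⟧ * y i)
    pointwise i j = Φ-change (I i) (I j) {m = size I} ⟦ not (infect (i , j) I s) ⟧ _ _ (size-infect {n} (i , j) I)
      ⟦ not (infect {n} (i , j) I s) ⟧≤1 (infect-stays-outʳ i j I s) (infect-stays-outˡ i j I s)
    one : ∑ (pairs n) (λ c → Φ s (infect c I)) + size I * suc l * w (size I)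
      ≤ N * w (size I) + size I * (l * w (suc (size I)))
    one = begin
      ∑ (pairs n) (λ c → Φ s (infect c I)) + size I * suc l * w (size I)
        ≡⟨ cong (λ u → ∑ (pairs n) (λ c → Φ s (infect c I)) + size I * u * w (size I)) l-suc ⟩
      ∑ (pairs n) (λ c → Φ s (infect c I)) + size I * cosize I * w (size I)
        ≤⟨ one-call I (w (size I)) y (λ c → Φ s (infect c I)) disjoint pointwise ⟩
      N * w (size I) + size I * ∑ᶠ y
        ≡⟨ cong (λ z → N * w (size I) + size I * z) (∑-*ʳ (w (suc (size I))) _ (allFin n)) ⟩
      N * w (size I) + size I * (l * w (suc (size I))) ∎
      where open ≤-Reasoning
    bound : ∀ m → size I ≡ m → suc e * ∑ (pairs n) (λ c → Φ s (infect c I)) ≤ B * w (size I)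
    bound m eq with one
    ... | h rewrite eq = go m (trans (cong₂ _+_ (sym eq) l-suc) (size+cosize I)) h
      where
      S = ∑ (pairs n) (λ c → Φ s (infect c I))
      go : ∀ m → m + suc l ≡ n → S + m * suc l * w m ≤ N * w m + m * (l * w (suc m)) →
        suc e * S ≤ B * w m
      go zero    _  h = ≤-trans (*-monoʳ-≤ (suc e) (≤-trans (m≤m+n S 0) h))
        (≤-reflexive (trans (cong (suc e *_) (trans (+-identityʳ (N * 0)) (*-zeroʳ N)))
          (trans (*-zeroʳ (suc e)) (sym (*-zeroʳ B)))))
      go (suc m) m+l h = +-cancelʳ-≤ (n′ * e * v m + X) _ _ (begin
        suc e * S + (n′ * e * v m + X)
          ≡⟨ lemma₁ (suc e) S (n′ * e * v m) (suc m) (suc l) (v m) ⟩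
        suc e * (S + suc m * suc l * v m) + n′ * e * v m
          ≤⟨ +-monoˡ-≤ (n′ * e * v m) (*-monoʳ-≤ (suc e) h) ⟩
        suc e * (N * v m + suc m * (l * v (suc m))) + n′ * e * v m
          ≡⟨ lemma₂ (suc e) N (v m) (suc m) l (v (suc m)) (n′ * e * v m) ⟩
        suc e * N * v m + (suc e * (suc m * l * v (suc m)) + n′ * e * v m)
          ≤⟨ +-monoʳ-≤ (suc e * N * v m) (w-drop m l m+l) ⟩
        suc e * N * v m + X
          ≡⟨ cong (λ z → z * v m + X) B-def ⟨
        (B + n′ * e) * v m + X
          ≡⟨ lemma₃ B (n′ * e) (v m) X ⟩
        B * v m + (n′ * e * v m + X) ∎)
        where
        open ≤-Reasoning
        X = suc e * (suc m * suc l * v m)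
        lemma₁ : ∀ a s d m l v → a * s + (d + a * (m * l * v)) ≡ a * (s + m * l * v) + d
        lemma₁ = solve-∀
        lemma₂ : ∀ a N v m l v′ d → a * (N * v + m * (l * v′)) + d ≡ a * N * v + (a * (m * l * v′) + d)
        lemma₂ = solve-∀
        lemma₃ : ∀ b d v x → (b + d) * v + x ≡ b * v + (d * v + x)
        lemma₃ = solve-∀

  Φ-step : ∀ s I → suc e * ∑ (pairs n) (λ c → Φ s (infect c I)) ≤ B * Φ s I
  Φ-step s I = by-cases (I s) refl
    where
    by-cases : ∀ b → I s ≡ b → suc e * ∑ (pairs n) (λ c → Φ s (infect c I)) ≤ B * Φ s I
    by-cases true  = Φ-step-informed s I
    by-cases false = Φ-step-uninformed s I

  -- Markov's inequality for Φ: while s is uninformed the potential is at least W / (1 + e n), and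
  -- it starts at no more than v 0 = W. The factor 1 + e n is the price of starting at size 1.
  count-not-reach-≤ : ∀ a s t →
    suc e ^ t * ∑ (seqs n t) (λ σ → ⟦ not (reach σ a s) ⟧) ≤ suc (e * n) * B ^ t
  count-not-reach-≤ a s t = *-cancelʳ-≤ _ _ W {{W≢0}} (begin
    suc e ^ t * ∑ (seqs n t) (λ σ → ⟦ not (reach σ a s) ⟧) * W
      ≡⟨ *-assoc (suc e ^ t) _ W ⟩
    suc e ^ t * (∑ (seqs n t) (λ σ → ⟦ not (reach σ a s) ⟧) * W)
      ≡⟨ cong (suc e ^ t *_) (∑-*ʳ W _ (seqs n t)) ⟨
    suc e ^ t * ∑ (seqs n t) (λ σ → ⟦ not (reach σ a s) ⟧ * W)
      ≤⟨ *-monoʳ-≤ (suc e ^ t) (∑-mono (seqs n t) (λ σ → Φ-lower σ)) ⟩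
    suc e ^ t * ∑ (seqs n t) (λ σ → suc (e * n) * Φ s (reach σ a))
      ≡⟨ cong (suc e ^ t *_) (∑-*ˡ (suc (e * n)) _ (seqs n t)) ⟩
    suc e ^ t * (suc (e * n) * ∑ (seqs n t) (λ σ → Φ s (reach σ a)))
      ≡⟨ lemma (suc e ^ t) (suc (e * n)) _ ⟩
    suc (e * n) * (suc e ^ t * ∑ (seqs n t) (λ σ → Φ s (reach σ a)))
      ≤⟨ *-monoʳ-≤ (suc (e * n)) (supermartingale (suc e) B (λ σ → Φ s (reach σ a))
           (λ σ → Φ-step s (reach σ a)) t) ⟩
    suc (e * n) * (B ^ t * Φ s (initial a))
      ≤⟨ *-monoʳ-≤ (suc (e * n)) (*-monoʳ-≤ (B ^ t) Φ-initial) ⟩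
    suc (e * n) * (B ^ t * W)
      ≡⟨ *-assoc (suc (e * n)) (B ^ t) W ⟨
    suc (e * n) * B ^ t * W ∎)
    where
    open ≤-Reasoning
    lemma : ∀ a b c → a * (b * c) ≡ b * (a * c)
    lemma = solve-∀
    w-lower : ∀ m → 1 ≤ m → m ≤ n → W ≤ suc (e * n) * w m
    w-lower (suc m) _ m<n = begin
      W                       ≡⟨ v-recip m (<⇒≤ m<n) ⟨
      v m * suc (e * m)       ≤⟨ *-monoʳ-≤ (v m) (s≤s (*-monoʳ-≤ e (<⇒≤ m<n))) ⟩
      v m * suc (e * n)       ≡⟨ *-comm (v m) _ ⟩
      suc (e * n) * v m       ∎
    Φ-lower : ∀ σ → ⟦ not (reach σ a s) ⟧ * W ≤ suc (e * n) * Φ s (reach σ a)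
    Φ-lower σ = ≤-trans
      (*-monoʳ-≤ ⟦ not (reach σ a s) ⟧ (w-lower (size (reach σ a)) (size-reach>0 σ a) (size≤n (reach σ a))))
      (≤-reflexive (lemma ⟦ not (reach σ a s) ⟧ (suc (e * n)) _))
    Φ-initial : Φ s (initial a) ≤ W
    Φ-initial = begin
      Φ s (initial a)               ≤⟨ *-monoˡ-≤ (w (size (initial a))) ⟦ not (initial a s) ⟧≤1 ⟩
      1 * w (size (initial a))      ≡⟨ *-identityˡ _ ⟩
      w (size (initial a))          ≡⟨ cong w (size-initial a) ⟩
      v 0                           ≡⟨ *-identityʳ (v 0) ⟨
      v 0 * 1                       ≡⟨ cong (λ z → v 0 * suc z) (*-zeroʳ e) ⟨
      v 0 * suc (e * 0)             ≡⟨ v-recip 0 z≤n ⟩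
      W                             ∎

-- Agents untouched by a stretch of calls

untouched : ∀ {n} → List (Call n) → Fin n → Bool
untouched []            a = true
untouched ((i , j) ∷ σ) a = not (⌊ a ≟ᶠ i ⌋ ∨ ⌊ a ≟ᶠ j ⌋) ∧ untouched σ a

run-untouched : ∀ {n} (K : Know n) σ a s → untouched σ a ≡ true → run K σ a s ≡ K a s
run-untouched K []            a s h = refl
run-untouched K ((i , j) ∷ σ) a s h with ⌊ a ≟ᶠ i ⌋ ∨ ⌊ a ≟ᶠ j ⌋ in eq
... | false = trans (run-untouched (step (i , j) K) σ a s h)
  (cong (λ b → (if b then (λ x → K i x ∨ K j x) else K a) s) eq)

-- The potential is 1 / (u + 3), u the number of untouched agents: the shift by 3 keeps the
-- denominators positive after a call, which decreases u by at most 2.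
module Untouched (n : ℕ) where

  private
    N = length (pairs n)
    recip = reciprocals (λ u → u + 3) (λ u → subst NonZero (+-comm 3 u) _) n
    D = proj₁ recip
    D≢0 = proj₁ (proj₂ recip)
    H = proj₁ (proj₂ (proj₂ recip))
    H-recip : ∀ u → u ≤ n → H u * (u + 3) ≡ D
    H-recip = proj₂ (proj₂ (proj₂ recip))

  size-untouched : ∀ i j σ → i ≢ j → let U = untouched {n} σ in
    size (untouched ((i , j) ∷ σ)) + (⟦ U i ⟧ + ⟦ U j ⟧) ≡ size U
  size-untouched i j σ i≢j = begin
    size (untouched ((i , j) ∷ σ)) + (⟦ U i ⟧ + ⟦ U j ⟧)
      ≡⟨ cong (size (untouched ((i , j) ∷ σ)) +_) (cong₂ _+_ (∑ᶠ-δ i (λ a → ⟦ U a ⟧)) (∑ᶠ-δ j (λ a → ⟦ U a ⟧))) ⟨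
    size (untouched ((i , j) ∷ σ)) + (∑ᶠ (λ a → δ a i * ⟦ U a ⟧) + ∑ᶠ (λ a → δ a j * ⟦ U a ⟧))
      ≡⟨ cong (size (untouched ((i , j) ∷ σ)) +_) (∑-+ (λ a → δ a i * ⟦ U a ⟧) (λ a → δ a j * ⟦ U a ⟧) (allFin n)) ⟨
    size (untouched ((i , j) ∷ σ)) + ∑ᶠ (λ a → δ a i * ⟦ U a ⟧ + δ a j * ⟦ U a ⟧)
      ≡⟨ ∑-+ (λ a → ⟦ untouched ((i , j) ∷ σ) a ⟧) (λ a → δ a i * ⟦ U a ⟧ + δ a j * ⟦ U a ⟧) (allFin n) ⟨
    ∑ᶠ (λ a → ⟦ untouched ((i , j) ∷ σ) a ⟧ + (δ a i * ⟦ U a ⟧ + δ a j * ⟦ U a ⟧))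
      ≡⟨ ∑-cong (allFin n) pointwise ⟩
    size U ∎
    where
    open ≡-Reasoning
    U = untouched σ
    pointwise : ∀ a → ⟦ untouched ((i , j) ∷ σ) a ⟧ + (δ a i * ⟦ U a ⟧ + δ a j * ⟦ U a ⟧) ≡ ⟦ U a ⟧
    pointwise a with a ≟ᶠ i | a ≟ᶠ j
    ... | yes refl | yes refl = contradiction refl i≢j
    ... | yes refl | no _     = trans (+-identityʳ (⟦ U a ⟧ + 0)) (+-identityʳ ⟦ U a ⟧)
    ... | no _     | yes refl = +-identityʳ ⟦ U a ⟧
    ... | no _     | no _     = +-identityʳ ⟦ U a ⟧

  H-change-one : ∀ u {m} → m + 1 ≡ u → u ≤ n →
    suc u * (u + 2) * H m ≡ H u * (suc u * (u + 2) + 1 * suc u + 0)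
  H-change-one u {m} refl u≤n rewrite +-comm m 1 = begin
    suc (suc m) * (suc m + 2) * H m           ≡⟨ lemma₁ m (H m) ⟩
    suc (suc m) * (H m * (m + 3))             ≡⟨ cong (suc (suc m) *_) (trans (H-recip m (<⇒≤ u≤n)) (sym (H-recip (suc m) u≤n))) ⟩
    suc (suc m) * (H (suc m) * (suc m + 3))   ≡⟨ lemma₂ m (H (suc m)) ⟩
    H (suc m) * (suc (suc m) * (suc m + 2) + 1 * suc (suc m) + 0) ∎
    where
    open ≡-Reasoning
    lemma₁ : ∀ m h → (2 + m) * (1 + m + 2) * h ≡ (2 + m) * (h * (m + 3))
    lemma₁ = solve-∀
    lemma₂ : ∀ m h → (2 + m) * (h * (1 + m + 3)) ≡ h * ((2 + m) * (1 + m + 2) + 1 * (2 + m) + 0)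
    lemma₂ = solve-∀

  -- The ratio of new to old potential is 1 + 1/(u + 2) if one untouched agent is called and 1 +
  -- 2/(u + 1) if two are. The factor (u + 1)(u + 2) clears both; the last summand is the excess of
  -- two touched agents over twice the effect of one.
  H-change : ∀ b c u {m} → m + (⟦ b ⟧ + ⟦ c ⟧) ≡ u → u ≤ n →
    suc u * (u + 2) * H m
      ≡ H u * (suc u * (u + 2) + (⟦ b ⟧ + ⟦ c ⟧) * suc u + (⟦ b ⟧ * ⟦ c ⟧ + ⟦ c ⟧ * ⟦ b ⟧))
  H-change false false u {m} refl u≤n rewrite +-identityʳ m = lemma (suc m) (m + 2) (H m)
    where
    lemma : ∀ a b h → a * b * h ≡ h * (a * b + 0 + 0)
    lemma = solve-∀
  H-change true  false u eq u≤n = H-change-one u eq u≤n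
  H-change false true  u eq u≤n = H-change-one u eq u≤n
  H-change true true u {m} refl u≤n rewrite +-comm m 2 = begin
    suc (suc (suc m)) * (suc (suc m) + 2) * H m      ≡⟨ lemma₁ m (H m) ⟩
    (m + 4) * (H m * (m + 3))                        ≡⟨ cong ((m + 4) *_) (trans (H-recip m (<⇒≤ (<⇒≤ u≤n))) (sym (H-recip (suc (suc m)) u≤n))) ⟩
    (m + 4) * (H (suc (suc m)) * (suc (suc m) + 3))  ≡⟨ lemma₂ m (H (suc (suc m))) ⟩
    H (suc (suc m)) * (suc (suc (suc m)) * (suc (suc m) + 2) + 2 * suc (suc (suc m)) + 2) ∎
    where
    open ≡-Reasoning
    lemma₁ : ∀ m h → (3 + m) * (2 + m + 2) * h ≡ (m + 4) * (h * (m + 3))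
    lemma₁ = solve-∀
    lemma₂ : ∀ m h → (m + 4) * (h * (2 + m + 3)) ≡ h * ((3 + m) * (2 + m + 2) + 2 * (3 + m) + 2)
    lemma₂ = solve-∀

  Ω : List (Call n) → ℕ
  Ω σ = H (size (untouched σ))

  -- A call hits about 2u/n untouched agents on average and each adds a relative amount of about
  -- 1/u, so u cancels. The factor N + n is also the one in `count-reach-≤`, which lets
  -- `growth-half` serve both.
  Ω-step : ∀ σ → ∑ (pairs n) (λ c → Ω (c ∷ σ)) ≤ (N + n) * Ω σ
  Ω-step σ = *-cancelˡ-≤ (suc u * (u + 2)) {{subst (λ z → NonZero (suc u * z)) (+-comm 2 u) _}} (begin
    k * ∑ (pairs n) (λ c → Ω (c ∷ σ))
      ≡⟨ ∑-*ˡ k (λ c → Ω (c ∷ σ)) (pairs n) ⟨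
    ∑ (pairs n) (λ c → k * Ω (c ∷ σ))
      ≤⟨ ∑-mono-All (All.map (λ {(i , j)} i<j → ≤-reflexive (pointwise i j i<j)) (pairs-< n)) ⟩
    ∑ (pairs n) (λ c → H u * (k + single c * suc u + double c))
      ≡⟨ ∑-*ˡ (H u) (λ c → k + single c * suc u + double c) (pairs n) ⟩
    H u * ∑ (pairs n) (λ c → k + single c * suc u + double c)
      ≡⟨ cong (H u *_) (trans (∑-+ (λ c → k + single c * suc u) double (pairs n))
           (cong (_+ ∑ (pairs n) double) (∑-+ (λ _ → k) (λ c → single c * suc u) (pairs n)))) ⟩
    H u * (∑ (pairs n) (λ _ → k) + ∑ (pairs n) (λ c → single c * suc u) + ∑ (pairs n) double)
      ≡⟨ cong₂ (λ x y → H u * (x + y + ∑ (pairs n) double)) (∑-const k (pairs n)) (∑-*ʳ (suc u) single (pairs n)) ⟩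
    H u * (N * k + ∑ (pairs n) single * suc u + ∑ (pairs n) double)
      ≤⟨ *-monoʳ-≤ (H u) (+-mono-≤ (+-monoʳ-≤ (N * k) (*-monoˡ-≤ (suc u) ∑single)) ∑double) ⟩
    H u * (N * k + u * n * suc u + u * u)
      ≤⟨ *-monoʳ-≤ (H u) (+-monoʳ-≤ (N * k + u * n * suc u) (*-monoʳ-≤ u (size≤n U))) ⟩
    H u * (N * k + u * n * suc u + u * n)
      ≤⟨ *-monoʳ-≤ (H u) (m≤m+n _ (u * n + 2 * n)) ⟩
    H u * (N * k + u * n * suc u + u * n + (u * n + 2 * n))
      ≡⟨ lemma (H u) N u n ⟩
    k * ((N + n) * H u) ∎)
    where
    open ≤-Reasoning
    U = untouched σ
    u = size U
    k = suc u * (u + 2)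
    single double : Call n → ℕ
    single (i , j) = ⟦ U i ⟧ + ⟦ U j ⟧
    double (i , j) = ⟦ U i ⟧ * ⟦ U j ⟧ + ⟦ U j ⟧ * ⟦ U i ⟧
    ∑single : ∑ (pairs n) single ≤ u * n
    ∑single = begin
      ∑ (pairs n) single
        ≡⟨ ∑-cong (pairs n) (λ (i , j) → cong₂ _+_ (*-identityʳ ⟦ U i ⟧) (*-identityʳ ⟦ U j ⟧)) ⟨
      ∑ (pairs n) (λ (i , j) → ⟦ U i ⟧ * 1 + ⟦ U j ⟧ * 1)
        ≤⟨ m≤m+n _ _ ⟩
      ∑ (pairs n) (λ (i , j) → ⟦ U i ⟧ * 1 + ⟦ U j ⟧ * 1) + ∑ᶠ (λ i → ⟦ U i ⟧ * 1)
        ≡⟨ ∑-pairs-product n (λ i → ⟦ U i ⟧) (λ _ → 1) ⟩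
      u * ∑ᶠ {n} (λ _ → 1)
        ≡⟨ cong (u *_) (trans (∑ᶠ-const n 1) (*-identityʳ n)) ⟩
      u * n ∎
    ∑double : ∑ (pairs n) double ≤ u * u
    ∑double = ≤-trans (m≤m+n _ _)
      (≤-reflexive (∑-pairs-product n (λ i → ⟦ U i ⟧) (λ i → ⟦ U i ⟧)))
    pointwise : ∀ i j → toℕ i < toℕ j →
      k * Ω ((i , j) ∷ σ) ≡ H u * (k + single (i , j) * suc u + double (i , j))
    pointwise i j i<j = H-change (U i) (U j) u
      (size-untouched i j σ (λ i≡j → <⇒≢ i<j (cong toℕ i≡j))) (size≤n U)
    lemma : ∀ h N u n → h * (N * ((1 + u) * (u + 2)) + u * n * (1 + u) + u * n + (u * n + 2 * n))
      ≡ (1 + u) * (u + 2) * ((N + n) * h)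
    lemma = solve-∀

  -- Markov's inequality once more: the potential is D / 3 when nobody is untouched, and it starts
  -- at D / (n + 3).
  count-none-untouched-≤ : ∀ t →
    n * ∑ (seqs n t) (λ σ → ⟦ size (untouched σ) ≡ᵇ 0 ⟧) ≤ 3 * (N + n) ^ t
  count-none-untouched-≤ t = *-cancelʳ-≤ _ _ D {{D≢0}} (begin
    n * Z * D                       ≤⟨ *-monoˡ-≤ D (*-monoˡ-≤ Z (m≤m+n n 3)) ⟩
    (n + 3) * Z * D                 ≡⟨ *-assoc (n + 3) Z D ⟩
    (n + 3) * (Z * D)               ≡⟨ cong ((n + 3) *_) (∑-*ʳ D _ (seqs n t)) ⟨
    (n + 3) * ∑ (seqs n t) (λ σ → ⟦ size (untouched σ) ≡ᵇ 0 ⟧ * D)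
      ≤⟨ *-monoʳ-≤ (n + 3) (∑-mono (seqs n t) Ω-lower) ⟩
    (n + 3) * ∑ (seqs n t) (λ σ → Ω σ * 3)
      ≡⟨ cong ((n + 3) *_) (∑-*ʳ 3 Ω (seqs n t)) ⟩
    (n + 3) * (∑ (seqs n t) Ω * 3)
      ≡⟨ cong (λ z → (n + 3) * (z * 3)) (trans (cong (_* ∑ (seqs n t) Ω) (^-zeroˡ t)) (*-identityˡ _)) ⟨
    (n + 3) * (1 ^ t * ∑ (seqs n t) Ω * 3)
      ≤⟨ *-monoʳ-≤ (n + 3) (*-monoˡ-≤ 3 (supermartingale 1 (N + n) Ω
           (λ σ → ≤-trans (≤-reflexive (*-identityˡ _)) (Ω-step σ)) t)) ⟩
    (n + 3) * ((N + n) ^ t * Ω [] * 3)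
      ≡⟨ cong (λ z → (n + 3) * ((N + n) ^ t * H z * 3)) (trans (∑ᶠ-const n 1) (*-identityʳ n)) ⟩
    (n + 3) * ((N + n) ^ t * H n * 3)
      ≡⟨ lemma (n + 3) ((N + n) ^ t) (H n) ⟩
    3 * (N + n) ^ t * (H n * (n + 3))
      ≡⟨ cong (3 * (N + n) ^ t *_) (H-recip n ≤-refl) ⟩
    3 * (N + n) ^ t * D ∎)
    where
    open ≤-Reasoning
    Z = ∑ (seqs n t) (λ σ → ⟦ size (untouched σ) ≡ᵇ 0 ⟧)
    lemma : ∀ a b h → a * (b * h * 3) ≡ 3 * b * (h * a)
    lemma = solve-∀
    Ω-lower : ∀ σ → ⟦ size (untouched σ) ≡ᵇ 0 ⟧ * D ≤ Ω σ * 3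
    Ω-lower σ with size (untouched σ)
    ... | zero  = ≤-reflexive (trans (*-identityˡ D) (sym (H-recip 0 z≤n)))
    ... | suc _ = z≤n

-- Powers of (M + 1)/M

n<2^n : ∀ n → n < 2 ^ n
n<2^n zero    = ≤-refl
n<2^n (suc n) = begin
  suc (suc n)        ≤⟨ s≤s (n<2^n n) ⟩
  1 + 2 ^ n          ≤⟨ +-mono-≤ (m^n>0 2 n) (m≤m+n (2 ^ n) 0) ⟩
  2 ^ suc n          ∎
  where open ≤-Reasoning

-- Estimates in powers of the base (M + 1) / M, which stand in for exponentials.
module Base (M : ℕ) {{_ : NonZero M}} where

  b : ℕ
  b = M + 1

  private
    instance
      b≢0 : NonZero b
      b≢0 = subst NonZero (+-comm 1 M) _

    M≤b : M ≤ b
    M≤b = m≤m+n M 1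

  double≤ : ∀ M .{{_ : NonZero M}} → 2 * M ^ M ≤ (M + 1) ^ M
  double≤ M@(suc m) = begin
    2 * M ^ M                   ≡⟨ lemma M (M ^ m) ⟩
    M ^ M + M * 1 * M ^ m       ≤⟨ bernoulli-lower M 1 m ⟩
    (M + 1) ^ M                 ∎
    where
    open ≤-Reasoning
    lemma : ∀ M x → 2 * (M * x) ≡ M * x + M * 1 * x
    lemma = solve-∀

  2^g≤base : ∀ g → 2 ^ g * M ^ (M * g) ≤ b ^ (M * g)
  2^g≤base g = begin
    2 ^ g * M ^ (M * g)      ≡⟨ cong (2 ^ g *_) (^-*-assoc M M g) ⟨
    2 ^ g * (M ^ M) ^ g      ≡⟨ ^-distribʳ-* g 2 (M ^ M) ⟨
    (2 * M ^ M) ^ g          ≤⟨ ^-monoˡ-≤ g (double≤ M) ⟩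
    (b ^ M) ^ g              ≡⟨ ^-*-assoc b M g ⟩
    b ^ (M * g)              ∎
    where open ≤-Reasoning

  -- With β = b / M, Bernoulli's inequality gives β^M ≥ 2, so a constant up to `2 ^ g` costs `M * g`
  -- in the exponent of β.
  gap : ∀ {g K E F} → K ≤ 2 ^ g → E + M * g ≤ F → K * b ^ E * M ^ F ≤ b ^ F * M ^ E
  gap {g} {K} {E} {F} K≤2^g E+Mg≤F with x , refl ← m≤n⇒∃[o]m+o≡n E+Mg≤F = begin
    K * b ^ E * M ^ (E + M * g + x)
      ≡⟨ cong (K * b ^ E *_) (split M) ⟩
    K * b ^ E * (M ^ E * M ^ (M * g) * M ^ x)
      ≡⟨ lemma K (b ^ E) (M ^ E) (M ^ (M * g)) (M ^ x) ⟩
    b ^ E * (K * M ^ (M * g)) * M ^ x * M ^ E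
      ≤⟨ *-monoˡ-≤ (M ^ E) (*-mono-≤ (*-monoʳ-≤ (b ^ E) (≤-trans (*-monoˡ-≤ (M ^ (M * g)) K≤2^g) (2^g≤base g)))
           (^-monoˡ-≤ x M≤b)) ⟩
    b ^ E * b ^ (M * g) * b ^ x * M ^ E
      ≡⟨ cong (_* M ^ E) (split b) ⟨
    b ^ (E + M * g + x) * M ^ E ∎
    where
    open ≤-Reasoning
    split : ∀ y → y ^ (E + M * g + x) ≡ y ^ E * y ^ (M * g) * y ^ x
    split y = trans (^-distribˡ-+-* y (E + M * g) x) (cong (_* y ^ x) (^-distribˡ-+-* y E (M * g)))
    lemma : ∀ k e m y x → k * e * (m * y * x) ≡ e * (k * y) * x * m
    lemma = solve-∀

  -- The chain (1 + p/q)^t ≤ β^E, K β^E ≤ β^F, β^F ≤ X with β = b / M. The first link uses e^(1/b) ≤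
  -- β, hence the b in the rate hypothesis; `decay-bound` uses β ≤ e^(1/M), hence the M there.
  growth-bound : ∀ p q t {E F K X} →
    p * t * b ≤ E * q → K * b ^ E * M ^ F ≤ b ^ F * M ^ E → b ^ F ≤ X * M ^ F →
    K * (q + p) ^ t ≤ q ^ t * X
  growth-bound p q t {E} {F} {K} {X} h₁ h₂ h₃ =
    *-cancelʳ-≤ _ _ (M ^ F * M ^ E) {{m*n≢0 (M ^ F) (M ^ E) {{m^n≢0 M F}} {{m^n≢0 M E}}}} (begin
    K * (q + p) ^ t * (M ^ F * M ^ E)       ≡⟨ lemma₁ K ((q + p) ^ t) (M ^ F) (M ^ E) ⟩
    (q + p) ^ t * M ^ E * (K * M ^ F)
      ≤⟨ *-monoˡ-≤ (K * M ^ F) (power-comparison p q t 1 M E (subst (λ z → p * t * b ≤ z * q) (sym (*-identityˡ E)) h₁)) ⟩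
    q ^ t * b ^ E * (K * M ^ F)             ≡⟨ lemma₂ (q ^ t) (b ^ E) K (M ^ F) ⟩
    q ^ t * (K * b ^ E * M ^ F)             ≤⟨ *-monoʳ-≤ (q ^ t) h₂ ⟩
    q ^ t * (b ^ F * M ^ E)                 ≤⟨ *-monoʳ-≤ (q ^ t) (*-monoˡ-≤ (M ^ E) h₃) ⟩
    q ^ t * (X * M ^ F * M ^ E)             ≡⟨ lemma₃ (q ^ t) X (M ^ F) (M ^ E) ⟩
    q ^ t * X * (M ^ F * M ^ E)             ∎)
    where
    open ≤-Reasoning
    lemma₁ : ∀ k x f e → k * x * (f * e) ≡ x * e * (k * f)
    lemma₁ = solve-∀
    lemma₂ : ∀ q b k f → q * b * (k * f) ≡ q * (k * b * f)
    lemma₂ = solve-∀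
    lemma₃ : ∀ q x f e → q * (x * f * e) ≡ q * x * (f * e)
    lemma₃ = solve-∀

  decay-bound : ∀ p q t .{{_ : NonZero (q + p)}} {E F K X} →
    E * (q + p) ≤ p * t * M → K * b ^ F * M ^ E ≤ b ^ E * M ^ F → X * M ^ F ≤ b ^ F →
    K * X * q ^ t ≤ (q + p) ^ t
  decay-bound p q t {E} {F} {K} {X} h₁ h₂ h₃ =
    *-cancelʳ-≤ _ _ (M ^ F * M ^ E) {{m*n≢0 (M ^ F) (M ^ E) {{m^n≢0 M F}} {{m^n≢0 M E}}}} (begin
    K * X * q ^ t * (M ^ F * M ^ E)         ≡⟨ lemma₁ K X (q ^ t) (M ^ F) (M ^ E) ⟩
    K * (X * M ^ F) * M ^ E * q ^ t         ≤⟨ *-monoˡ-≤ (q ^ t) (*-monoˡ-≤ (M ^ E) (*-monoʳ-≤ K h₃)) ⟩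
    K * b ^ F * M ^ E * q ^ t               ≤⟨ *-monoˡ-≤ (q ^ t) h₂ ⟩
    b ^ E * M ^ F * q ^ t                   ≡⟨ lemma₂ (b ^ E) (M ^ F) (q ^ t) ⟩
    M ^ F * (b ^ E * q ^ t)
      ≤⟨ *-monoʳ-≤ (M ^ F) (power-comparison 1 M E p q t (subst (λ z → z * (q + p) ≤ p * t * M) (sym (*-identityˡ E)) h₁)) ⟩
    M ^ F * (M ^ E * (q + p) ^ t)           ≡⟨ lemma₃ (M ^ F) (M ^ E) ((q + p) ^ t) ⟩
    (q + p) ^ t * (M ^ F * M ^ E)           ∎)
    where
    open ≤-Reasoning
    lemma₁ : ∀ k x q f e → k * x * q * (f * e) ≡ k * (x * f) * e * q
    lemma₁ = solve-∀
    lemma₂ : ∀ b f q → b * f * q ≡ f * (b * q)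
    lemma₂ = solve-∀
    lemma₃ : ∀ f e q → f * (e * q) ≡ q * (f * e)
    lemma₃ = solve-∀

  -- r is the floor of log n to the base ((M + 1) / M) ^ R.
  bracket : ∀ R → M ≤ R → ∀ n r₀ → b ^ (R * r₀) ≤ n * M ^ (R * r₀) →
    ∃ λ r → r₀ ≤ r × b ^ (R * r) ≤ n * M ^ (R * r) × n * M ^ (R * suc r) ≤ b ^ (R * suc r)
  bracket R M≤R n r₀ = search n r₀ (upper (m≤n+m n r₀))
    where
    open ≤-Reasoning
    upper : ∀ {r} → n ≤ r → n * M ^ (R * r) ≤ b ^ (R * r)
    upper {r} n≤r with x , refl ← m≤n⇒∃[o]m+o≡n M≤R = begin
      n * M ^ ((M + x) * r)             ≡⟨ cong (n *_) (split M) ⟩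
      n * (M ^ (M * r) * M ^ (x * r))   ≡⟨ *-assoc n _ _ ⟨
      n * M ^ (M * r) * M ^ (x * r)
        ≤⟨ *-mono-≤ (*-monoˡ-≤ (M ^ (M * r)) (≤-trans n≤r (<⇒≤ (n<2^n r)))) (^-monoˡ-≤ (x * r) M≤b) ⟩
      2 ^ r * M ^ (M * r) * b ^ (x * r) ≤⟨ *-monoˡ-≤ (b ^ (x * r)) (2^g≤base r) ⟩
      b ^ (M * r) * b ^ (x * r)         ≡⟨ split b ⟨
      b ^ ((M + x) * r)                 ∎
      where
      split : ∀ y → y ^ ((M + x) * r) ≡ y ^ (M * r) * y ^ (x * r)
      split y = trans (cong (y ^_) (*-distribʳ-+ r M x)) (^-distribˡ-+-* y (M * r) (x * r))
    next : ∀ r → n * M ^ (R * r) ≤ b ^ (R * r) → n * M ^ (R * suc r) ≤ b ^ (R * suc r)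
    next r h = begin
      n * M ^ (R * suc r)              ≡⟨ cong (n *_) (split M) ⟩
      n * (M ^ (R * r) * M ^ R)        ≡⟨ *-assoc n _ _ ⟨
      n * M ^ (R * r) * M ^ R          ≤⟨ *-mono-≤ h (^-monoˡ-≤ R M≤b) ⟩
      b ^ (R * r) * b ^ R              ≡⟨ split b ⟨
      b ^ (R * suc r)                  ∎
      where
      split : ∀ y → y ^ (R * suc r) ≡ y ^ (R * r) * y ^ R
      split y = trans (cong (y ^_) (trans (*-suc R r) (+-comm R (R * r)))) (^-distribˡ-+-* y (R * r) R)
    search : ∀ k r₀ → n * M ^ (R * (r₀ + k)) ≤ b ^ (R * (r₀ + k)) → b ^ (R * r₀) ≤ n * M ^ (R * r₀) →
      ∃ λ r → r₀ ≤ r × b ^ (R * r) ≤ n * M ^ (R * r) × n * M ^ (R * suc r) ≤ b ^ (R * suc r)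
    search zero    r₀ u l = r₀ , ≤-refl , l ,
      next r₀ (subst (λ r → n * M ^ (R * r) ≤ b ^ (R * r)) (+-identityʳ r₀) u)
    search (suc k) r₀ u l with b ^ (R * suc r₀) ≤? n * M ^ (R * suc r₀)
    ... | no  ≰ = r₀ , ≤-refl , l , <⇒≤ (≰⇒> ≰)
    ... | yes l′ with r , r₀<r , rest ← search k (suc r₀)
                   (subst (λ r → n * M ^ (R * r) ≤ b ^ (R * r)) (+-suc r₀ k) u) l′
                 = r , <⇒≤ r₀<r , rest

-- The exponent s makes an early expert a given agent with probability about n^{-2sδ} = n^{-2},
-- which beats the union over all agents. In decay estimates ε = 1/e must be below δ, and M is
-- large enough that (1 + 1/M)^M and (1 + 1/M)^{M+1} agree to within a margin below δ. The factor
-- 2^g absorbs the constants.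
module Parameters (d g : ℕ) where

  s M R r₀ e : ℕ
  s  = suc d
  M  = 6 * s
  R  = 2 * s * M * (M + 1)
  r₀ = s * (M + 3) + g
  e  = 2 * d + 3

  open Base M public

  -- `n-large` absorbs lower order terms: n + s exceeds n′ by a factor of at most (M + 3) / (M + 1).
  module Times {n n′ N r : ℕ}
    (n≡1+n′ : n ≡ suc n′) (n′≢0 : NonZero n′) (2N+n≡n² : 2 * N + n ≡ n * n)
    (n-large : (n + s) * b ≤ (M + 3) * n′)
    (r₀≤r : r₀ ≤ r)
    (n-lower : b ^ (R * r) ≤ n * M ^ (R * r))
    (n-upper : n * M ^ (R * suc r) ≤ b ^ (R * suc r)) where

    -- (1 - δ) and (1 + δ) times ½ n log n, with δ = 1/(d+1), up to lower order terms.
    lo hi : ℕ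
    lo = n * suc r * d * b
    hi = n * r * suc (suc d) * M

    2N≡nn′ : 2 * N ≡ n * n′
    2N≡nn′ = +-cancelʳ-≡ n _ _ (trans 2N+n≡n² (trans (cong (n *_) n≡1+n′) (trans (*-suc n n′) (+-comm n _))))

    halve : ∀ {x y} → 2 * x ≤ y * (n * n′) → x ≤ y * N
    halve {x} {y} hyp = *-cancelˡ-≤ 2 (≤-trans hyp (≤-reflexive
      (trans (cong (y *_) (sym 2N≡nn′)) (lemma y N))))
      where
      lemma : ∀ y N → y * (2 * N) ≡ 2 * (y * N)
      lemma = solve-∀

    n-lower^ : ∀ k → b ^ (R * r * k) ≤ n ^ k * M ^ (R * r * k)
    n-lower^ k = begin
      b ^ (R * r * k)             ≡⟨ ^-*-assoc b (R * r) k ⟨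
      (b ^ (R * r)) ^ k           ≤⟨ ^-monoˡ-≤ k n-lower ⟩
      (n * M ^ (R * r)) ^ k       ≡⟨ ^-distribʳ-* k n (M ^ (R * r)) ⟩
      n ^ k * (M ^ (R * r)) ^ k   ≡⟨ cong (n ^ k *_) (^-*-assoc M (R * r) k) ⟩
      n ^ k * M ^ (R * r * k)     ∎
      where open ≤-Reasoning

    n-upper^ : ∀ k → n ^ k * M ^ (R * suc r * k) ≤ b ^ (R * suc r * k)
    n-upper^ k = begin
      n ^ k * M ^ (R * suc r * k)     ≡⟨ cong (n ^ k *_) (^-*-assoc M (R * suc r) k) ⟨
      n ^ k * (M ^ (R * suc r)) ^ k   ≡⟨ ^-distribʳ-* k n (M ^ (R * suc r)) ⟨
      (n * M ^ (R * suc r)) ^ k       ≤⟨ ^-monoˡ-≤ k n-upper ⟩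
      (b ^ (R * suc r)) ^ k           ≡⟨ ^-*-assoc b (R * suc r) k ⟩
      b ^ (R * suc r * k)             ∎
      where open ≤-Reasoning

    -- With β = b / M, log n ≤ R (r + 1) log β ≤ R (r + 1) / M, so `suc r` and `b` in `lo` round
    -- upwards, as the lower end of the window requires; `expLe-upper` rounds downwards by log n ≥ R
    -- r / b. R = 2 s M b makes both quotients integral. P / Q = p / 2, so p counts the units of ½ n
    -- log n.
    expGe-lower : ∀ P Q p → 2 * P ≡ p * Q → ExpGe (p * lo * Q * suc d) (n ^ (P * d * n))
    expGe-lower P Q p 2P≡pQ = power⇒ExpGe M (p * lo * Q * suc d) (n ^ (P * d * n))
      (subst (λ k → n ^ (P * d * n) * M ^ k ≤ b ^ k) eq (n-upper^ (P * d * n)))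
      where
      eq : R * suc r * (P * d * n) ≡ M * (p * lo * Q * suc d)
      eq = trans (lemma₁ s M b (suc r) P d n)
        (trans (cong (λ z → z * (s * M * b * suc r * d * n)) 2P≡pQ) (lemma₂ s M b (suc r) d n p Q))
        where
        lemma₁ : ∀ s M b r P d n → 2 * s * M * b * r * (P * d * n) ≡ 2 * P * (s * M * b * r * d * n)
        lemma₁ = solve-∀
        lemma₂ : ∀ s M b r d n p Q → p * Q * (s * M * b * r * d * n) ≡ M * (p * (n * r * d * b) * Q * s)
        lemma₂ = solve-∀

    expLe-upper : ∀ P Q p → 2 * P ≡ p * Q → ExpLe (p * hi * Q * suc d) (n ^ (P * suc (suc d) * n))
    expLe-upper P Q p 2P≡pQ = power⇒ExpLe M (p * hi * Q * suc d) (n ^ (P * suc (suc d) * n))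
      (subst (λ k → b ^ k ≤ n ^ (P * suc (suc d) * n) * M ^ k) eq (n-lower^ (P * suc (suc d) * n)))
      where
      eq : R * r * (P * suc (suc d) * n) ≡ b * (p * hi * Q * suc d)
      eq = trans (lemma₁ s M b r P (suc (suc d)) n)
        (trans (cong (λ z → z * (s * M * b * r * suc (suc d) * n)) 2P≡pQ) (lemma₂ s M b r (suc (suc d)) n p Q))
        where
        lemma₁ : ∀ s M b r P d n → 2 * s * M * b * r * (P * d * n) ≡ 2 * P * (s * M * b * r * d * n)
        lemma₁ = solve-∀
        lemma₂ : ∀ s M b r d n p Q → p * Q * (s * M * b * r * d * n) ≡ b * (p * (n * r * d * M) * Q * s)
        lemma₂ = solve-∀

    private
      -- With r written as `r₀ + slack`, each comparison of exponents below becomes a polynomial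
      -- identity with an explicit non-negative remainder.
      slack : ℕ
      slack = proj₁ (m≤n⇒∃[o]m+o≡n r₀≤r)
      r≡ : r₀ + slack ≡ r
      r≡ = proj₂ (m≤n⇒∃[o]m+o≡n r₀≤r)

    lo≤hi : lo ≤ hi
    lo≤hi = subst₂ _≤_ (lemma n (suc r) d b) (lemma n r (suc (suc d)) M)
      (*-monoʳ-≤ n (subst (λ r → suc r * d * b ≤ r * suc (suc d) * M) r≡
        (≤-trans (m≤m+n _ _) (≤-reflexive (identity d g slack)))))
      where
      lemma : ∀ n r d b → n * (r * d * b) ≡ n * r * d * b
      lemma = solve-∀
      identity : ∀ d g x → let M = 6 * (1 + d); r = (1 + d) * (M + 3) + g + x in
        (1 + r) * d * (M + 1) + (r * (11 * d + 11) + 2 * d + M + 3 + g + x) ≡ r * (2 + d) * M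
      identity = solve-∀

    -- (1 + n/N)^lo is about n^(1 - δ), apart from a rounding factor (M + 3) / M in the exponent; d
    -- (M + 3) < (d + 1) M leaves room for K.
    growth-half : ∀ {K} → K ≤ 2 ^ g → K * (N + n) ^ lo ≤ N ^ lo * n
    growth-half {K} K≤ = subst (λ z → K * (N + n) ^ lo ≤ N ^ lo * z) (*-identityʳ n)
      (growth-bound n N lo {E} {R * r * 1} {K} (halve {y = E} rate) (gap {g} {K} {E} {R * r * 1} K≤ exponents) (n-lower^ 1))
      where
      E = 2 * suc r * d * b * (M + 3)
      rate : 2 * (n * lo * b) ≤ E * (n * n′)
      rate = begin
        2 * (n * lo * b)                               ≡⟨ lemma₁ n (suc r) d b ⟩
        2 * suc r * d * b * n * (n * b)               ≤⟨ *-monoʳ-≤ (2 * suc r * d * b * n) (≤-trans (*-monoˡ-≤ b (m≤m+n n s)) n-large) ⟩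
        2 * suc r * d * b * n * ((M + 3) * n′)        ≡⟨ lemma₂ (suc r) d b n (M + 3) n′ ⟩
        E * (n * n′)                                  ∎
        where
        open ≤-Reasoning
        lemma₁ : ∀ n r d b → 2 * (n * (n * r * d * b) * b) ≡ 2 * r * d * b * n * (n * b)
        lemma₁ = solve-∀
        lemma₂ : ∀ r d b n m n′ → 2 * r * d * b * n * (m * n′) ≡ 2 * r * d * b * m * (n * n′)
        lemma₂ = solve-∀
      exponents : E + M * g ≤ R * r * 1
      exponents = subst (λ r → 2 * suc r * d * b * (M + 3) + M * g ≤ R * r * 1) r≡
        (≤-trans (m≤m+n _ _) (≤-reflexive (identity d g slack)))
        where
        identity : ∀ d g x → let M = 6 * (1 + d); r = (1 + d) * (M + 3) + g + x in
          2 * (1 + r) * d * (M + 1) * (M + 3) + M * g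
            + (2 * (M + 1) * ((3 * d + 5) * r + M + 3 + x) + (M + 2) * g)
          ≡ 2 * (1 + d) * M * (M + 1) * r * 1
        identity = solve-∀

    -- The target exponent is 2s - 1: of the n^(2s) gained by the potential, one factor n is
    -- reserved for the union over agents. The exponents compare if 2 d (M + 3) < (2 d + 1) M, that
    -- is 6 d < M, which is the origin of M = 6 s.
    growth-full : ∀ {K} → K ≤ 2 ^ g →
      K * (N + s * (n + s)) ^ (2 * lo) ≤ N ^ (2 * lo) * n ^ (d + suc d)
    growth-full {K} K≤ = growth-bound (s * (n + s)) N (2 * lo) {E} {F} {K} {n ^ (d + suc d)}
      (halve {y = E} rate) (gap {g} {K} {E} {F} K≤ exponents) (n-lower^ (d + suc d))
      where
      E = 4 * s * suc r * d * b * (M + 3)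
      F = R * r * (d + suc d)
      rate : 2 * (s * (n + s) * (2 * lo) * b) ≤ E * (n * n′)
      rate = begin
        2 * (s * (n + s) * (2 * lo) * b)                   ≡⟨ lemma₁ s (n + s) n (suc r) d b ⟩
        4 * s * suc r * d * b * n * ((n + s) * b)         ≤⟨ *-monoʳ-≤ (4 * s * suc r * d * b * n) n-large ⟩
        4 * s * suc r * d * b * n * ((M + 3) * n′)        ≡⟨ lemma₂ s (suc r) d b n (M + 3) n′ ⟩
        E * (n * n′)                                      ∎
        where
        open ≤-Reasoning
        lemma₁ : ∀ s t n r d b → 2 * (s * t * (2 * (n * r * d * b)) * b) ≡ 4 * s * r * d * b * n * (t * b)
        lemma₁ = solve-∀
        lemma₂ : ∀ s r d b n m n′ → 4 * s * r * d * b * n * (m * n′) ≡ 4 * s * r * d * b * m * (n * n′)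
        lemma₂ = solve-∀
      exponents : E + M * g ≤ F
      exponents = subst (λ r → 4 * s * suc r * d * b * (M + 3) + M * g ≤ R * r * (d + suc d)) r≡
        (≤-trans (m≤m+n _ _) (≤-reflexive (identity d g slack)))
        where
        identity : ∀ d g x → let M = 6 * (1 + d); r = (1 + d) * (M + 3) + g + x in
          4 * (1 + d) * (1 + r) * d * (M + 1) * (M + 3) + M * g
            + (2 * (1 + d) * (M + 1) * (4 * r + 2 * (M + 3) + 2 * x) + (4 * d * M + 4 * d + 3 * M + 4) * g)
          ≡ 2 * (1 + d) * M * (M + 1) * r * (d + (1 + d))
        identity = solve-∀

    -- `hi` carries 1 + δ = (d + 2) / (d + 1) and the rate carries 1 / (1 + ε) = (2 d + 3) / (2 d +
    -- 4). Their product (2 d + 3) / (2 d + 2) exceeds 1, and 2 d + 2 < M keeps this margin when e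
    -- is replaced by powers of β.
    decay : ∀ {K B} → B + n′ * e ≡ suc e * N → K ≤ 2 ^ g → K * n * B ^ hi ≤ (suc e * N) ^ hi
    decay {K} {B} B-def K≤ = subst (λ z → K * n * B ^ hi ≤ z ^ hi) B-def
      (decay-bound (n′ * e) B hi {{q≢0}} {E} {F} {K} {n} rate
        (gap {g} {K} {F} {E} K≤ exponents) n-upper)
      where
      E = e * r * M * M
      F = R * suc r
      q≢0 : NonZero (B + n′ * e)
      q≢0 = >-nonZero (≤-trans (>-nonZero⁻¹ (n′ * e) {{m*n≢0 n′ e {{n′≢0}} {{subst NonZero (+-comm 3 (2 * d)) _}}}})
              (m≤n+m (n′ * e) B))
      rate : E * (B + n′ * e) ≤ n′ * e * hi * M
      rate = ≤-reflexive (trans (cong (E *_) B-def) (trans (lemma₁ d r M N)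
        (trans (cong (λ z → (2 * d + 3) * r * M * M * (2 + d) * z) 2N≡nn′) (lemma₂ d r M n n′))))
        where
        lemma₁ : ∀ d r M N → (2 * d + 3) * r * M * M * ((1 + (2 * d + 3)) * N)
          ≡ (2 * d + 3) * r * M * M * (2 + d) * (2 * N)
        lemma₁ = solve-∀
        lemma₂ : ∀ d r M n n′ → (2 * d + 3) * r * M * M * (2 + d) * (n * n′)
          ≡ n′ * (2 * d + 3) * (n * r * (2 + d) * M) * M
        lemma₂ = solve-∀
      exponents : F + M * g ≤ E
      exponents = subst (λ r → R * suc r + M * g ≤ e * r * M * M) r≡
        (≤-trans (m≤m+n _ _) (≤-reflexive (identity d g slack)))
        where
        identity : ∀ d g x → let M = 6 * (1 + d); r = (1 + d) * (M + 3) + g + x in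
          2 * (1 + d) * M * (M + 1) * (1 + r) + M * g
            + M * (2 * (1 + d) * r + 2 * (1 + d) * (d * (M + 3) + 2 + x) + (2 * d + 1) * g)
          ≡ (2 * d + 3) * r * M * M
        identity = solve-∀

-- Hitting times and events

_⊆_ : ∀ {n} → Know n → Know n → Set
K ⊆ K′ = ∀ a s → K a s ≡ true → K′ a s ≡ true

Monotone : ∀ {n} → (Know n → Bool) → Set
Monotone P = ∀ {K K′} → K ⊆ K′ → P K ≡ true → P K′ ≡ true

step-⊆ : ∀ {n} c (K : Know n) → K ⊆ step c K
step-⊆ c K a s h = trans (step≡infect c K a s) (infect-⊇ c (λ x → K x s) a h)

run-take-⊆ : ∀ {n} (K : Know n) σ t → run K (take t σ) ⊆ run K (take (suc t) σ)
run-take-⊆ K []      zero    a s h = h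
run-take-⊆ K []      (suc t) a s h = h
run-take-⊆ K (c ∷ σ) zero    a s h = step-⊆ c K a s h
run-take-⊆ K (c ∷ σ) (suc t) a s h = run-take-⊆ (step c K) σ t a s h

≡true⇒T : ∀ {b} → b ≡ true → T b
≡true⇒T = Equivalence.from T-≡

T⇒≡true : ∀ {b} → T b → b ≡ true
T⇒≡true = Equivalence.to T-≡

module _ {n : ℕ} {P : Know n → Bool} (mono : Monotone P) (σ : List (Call n)) where

  private
    at : ℕ → Bool
    at t = P (stateAt σ t)

  at-mono : ∀ {t t′} → t ≤ t′ → at t ≡ true → at t′ ≡ true
  at-mono {t} t≤t′ h with x , refl ← m≤n⇒∃[o]m+o≡n t≤t′ = go x
    where
    go : ∀ x → at (t + x) ≡ true
    go zero    = trans (cong at (+-identityʳ t)) h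
    go (suc x) = trans (cong at (+-suc t x)) (mono (run-take-⊆ initial σ (t + x)) (go x))

  first-time : ∀ lo x → at lo ≡ false → at (lo + x) ≡ true →
    ∃ λ t → lo ≤ t × suc t ≤ lo + x × at t ≡ false × at (suc t) ≡ true
  first-time lo zero    l u with () ← trans (sym l) (trans (cong at (sym (+-identityʳ lo))) u)
  first-time lo (suc x) l u with at (lo + x) in eq
  ... | false = lo + x , m≤m+n lo x , ≤-reflexive (sym (+-suc lo x)) , eq , trans (cong at (sym (+-suc lo x))) u
  ... | true  with t , lo≤t , t<hi , rest ← first-time lo x l eq =
    t , lo≤t , ≤-trans t<hi (+-monoʳ-≤ lo (n≤1+n x)) , rest

  inWindow-true : ∀ lo x → at lo ≡ false → at (lo + x) ≡ true → inWindow P lo (lo + x) σ ≡ true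
  inWindow-true lo x l u with t , lo≤t , t<hi , before , hit ← first-time lo x l u =
    T⇒≡true (any⁺ _ (lose (∈-upTo⁺ (s≤s t<hi)) (Equivalence.from (T-∧ {⌊ lo ≤? suc t ⌋})
      (fromWitness {a? = lo ≤? suc t} (≤-trans lo≤t (n≤1+n t)) , Equivalence.from T-∧
        (≡true⇒T hit , all⁻ _ (All.tabulate (λ {t′} t′∈ → ≡true⇒T (not-yet t′ (∈-upTo⁻ t′∈)))))))))
    where
    not-yet : ∀ t′ → t′ < suc t → not (at t′) ≡ true
    not-yet t′ (s≤s t′≤t) with at t′ in eq
    ... | false = refl
    ... | true  = trans (sym before) (at-mono t′≤t eq)

  -- A monotone property misses the window only by holding already at `lo` or still failing at the
  -- upper end; a hit exactly at `lo` is harmlessly counted as early.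
  window-split : ∀ lo x →
    1 ≤ ⟦ inWindow P lo (lo + x) σ ⟧ + (⟦ at lo ⟧ + ⟦ not (at (lo + x)) ⟧)
  window-split lo x with at lo in l
  ... | true  = ≤-trans (s≤s z≤n) (m≤n+m _ ⟦ inWindow P lo (lo + x) σ ⟧)
  ... | false with at (lo + x) in u
  ...   | false = m≤n+m 1 ⟦ inWindow P lo (lo + x) σ ⟧
  ...   | true  rewrite inWindow-true lo x l u = ≤-refl

∑-seqs-take : ∀ {n} t u (f : List (Call n) → ℕ) →
  ∑ (seqs n (t + u)) (λ σ → f (take t σ)) ≡ length (pairs n) ^ u * ∑ (seqs n t) f
∑-seqs-take {n} t u f = begin
  ∑ (seqs n (t + u)) (λ σ → f (take t σ))                ≡⟨ ∑-seqs-split t u (λ τ _ → f τ) ⟩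
  ∑ (seqs n t) (λ τ → ∑ (seqs n u) (λ _ → f τ))          ≡⟨ ∑-cong (seqs n t) (λ τ → ∑-seqs-const u (f τ)) ⟩
  ∑ (seqs n t) (λ τ → length (pairs n) ^ u * f τ)        ≡⟨ ∑-*ˡ (length (pairs n) ^ u) f (seqs n t) ⟩
  length (pairs n) ^ u * ∑ (seqs n t) f                  ∎
  where open ≡-Reasoning

-- Splitting off an empty second part spares a proof that all members of `seqs n t` have length t.
∑-seqs-all : ∀ {n} t (f : List (Call n) → ℕ) →
  ∑ (seqs n t) (λ σ → f (take t σ)) ≡ ∑ (seqs n t) f
∑-seqs-all {n} t f = trans (cong (λ u → ∑ (seqs n u) (λ σ → f (take t σ))) (sym (+-identityʳ t)))
  (trans (∑-seqs-take t 0 f) (*-identityˡ _))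

count : ∀ n → (Know n → Bool) → ℕ → ℕ
count n P t = ∑ (seqs n t) (λ σ → ⟦ P (run initial σ) ⟧)

-- Each tail receives half of the allowance 1 / (k + 1). The early tail, counted at time lo, is
-- extended to time hi by free later calls.
window : ∀ {n} P Q d k {X} → Monotone X → ∀ lo hi → lo ≤ hi →
  ExpGe (lo * Q * suc d) (n ^ (P * d * n)) →
  ExpLe (hi * Q * suc d) (n ^ (P * suc (suc d) * n)) →
  2 * suc k * count n X lo ≤ length (pairs n) ^ lo →
  2 * suc k * count n (not ∘ X) hi ≤ length (pairs n) ^ hi →
  Window n P Q d k X
window {n} P Q d k {X} mono lo hi lo≤hi expGe expLe early late
  with x , refl ← m≤n⇒∃[o]m+o≡n lo≤hi =
  lo , lo + x , expGe , expLe , *-cancelˡ-≤ 2 (+-cancelʳ-≤ (N ^ (lo + x) + N ^ (lo + x)) _ _ (begin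
    2 * (k * N ^ (lo + x)) + (N ^ (lo + x) + N ^ (lo + x))
      ≡⟨ lemma₁ k (N ^ (lo + x)) ⟩
    2 * suc k * N ^ (lo + x)
      ≤⟨ *-monoʳ-≤ (2 * suc k) total ⟩
    2 * suc k * (C + (N ^ x * L + H))
      ≡⟨ lemma₂ k C (N ^ x) L H ⟩
    2 * (suc k * C) + (N ^ x * (2 * suc k * L) + 2 * suc k * H)
      ≤⟨ +-monoʳ-≤ (2 * (suc k * C)) (+-mono-≤ (*-monoʳ-≤ (N ^ x) early) late) ⟩
    2 * (suc k * C) + (N ^ x * N ^ lo + N ^ (lo + x))
      ≡⟨ cong (λ z → 2 * (suc k * C) + (z + N ^ (lo + x)))
           (trans (*-comm (N ^ x) (N ^ lo)) (sym (^-distribˡ-+-* N lo x))) ⟩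
    2 * (suc k * C) + (N ^ (lo + x) + N ^ (lo + x)) ∎))
  where
  open ≤-Reasoning
  N = length (pairs n)
  C = countWindow n X lo (lo + x)
  L = count n X lo
  H = count n (not ∘ X) (lo + x)
  lemma₁ : ∀ k z → 2 * (k * z) + (z + z) ≡ 2 * (1 + k) * z
  lemma₁ = solve-∀
  lemma₂ : ∀ k c y l h → 2 * (1 + k) * (c + (y * l + h)) ≡ 2 * ((1 + k) * c) + (y * (2 * (1 + k) * l) + 2 * (1 + k) * h)
  lemma₂ = solve-∀
  S = seqs n (lo + x)
  total : N ^ (lo + x) ≤ C + (N ^ x * L + H)
  total = begin
    N ^ (lo + x)                      ≡⟨ *-identityʳ _ ⟨
    N ^ (lo + x) * 1                  ≡⟨ ∑-seqs-const (lo + x) 1 ⟨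
    ∑ S (λ _ → 1)                     ≤⟨ ∑-mono S (λ σ → window-split {P = X} mono σ lo x) ⟩
    ∑ S (λ σ → W σ + (A σ + Z σ))     ≡⟨ ∑-+ W (λ σ → A σ + Z σ) S ⟩
    ∑ S W + ∑ S (λ σ → A σ + Z σ)     ≡⟨ cong (∑ S W +_) (∑-+ A Z S) ⟩
    ∑ S W + (∑ S A + ∑ S Z)
      ≡⟨ cong₂ _+_ (sym (length-filter-T (inWindow X lo (lo + x)) S))
           (cong₂ _+_ (∑-seqs-take lo x (λ τ → ⟦ X (run initial τ) ⟧))
             (∑-seqs-all (lo + x) (λ τ → ⟦ not (X (run initial τ)) ⟧))) ⟩
    C + (N ^ x * L + H)               ∎
    where
    W A Z : List (Call n) → ℕ
    W σ = ⟦ inWindow X lo (lo + x) σ ⟧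
    A σ = ⟦ X (stateAt σ lo) ⟧
    Z σ = ⟦ not (X (stateAt σ (lo + x))) ⟧

-- Union bounds and monotonicity of the four properties

module _ {A : Set} (p : A → Bool) where

  ⟦any⟧≤∑ : ∀ xs → ⟦ any p xs ⟧ ≤ ∑ xs (λ x → ⟦ p x ⟧)
  ⟦any⟧≤∑ []       = z≤n
  ⟦any⟧≤∑ (x ∷ xs) with p x
  ... | true  = s≤s z≤n
  ... | false = ⟦any⟧≤∑ xs

  ⟦not-all⟧≤∑ : ∀ xs → ⟦ not (all p xs) ⟧ ≤ ∑ xs (λ x → ⟦ not (p x) ⟧)
  ⟦not-all⟧≤∑ []       = z≤n
  ⟦not-all⟧≤∑ (x ∷ xs) with p x
  ... | true  = ⟦not-all⟧≤∑ xs
  ... | false = s≤s z≤n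

⇒⟦⟧≤ : ∀ {b c} → (b ≡ true → c ≡ true) → ⟦ b ⟧ ≤ ⟦ c ⟧
⇒⟦⟧≤ {false}         h = z≤n
⇒⟦⟧≤ {true}  {true}  h = ≤-refl
⇒⟦⟧≤ {true}  {false} h with () ← h refl

⇒⟦not⟧≤ : ∀ {b c} → (b ≡ true → c ≡ true) → ⟦ not c ⟧ ≤ ⟦ not b ⟧
⇒⟦not⟧≤ {c = true}          h = z≤n
⇒⟦not⟧≤ {false} {c = false} h = ≤-refl
⇒⟦not⟧≤ {true}  {c = false} h with () ← h refl

any-true : ∀ {n} (p : Fin n → Bool) x → p x ≡ true → any p (allFin n) ≡ true
any-true p x h = T⇒≡true (any⁺ p (lose (∈-allFin x) (≡true⇒T h)))

all-mono : ∀ {n} (p q : Fin n → Bool) → (∀ x → p x ≡ true → q x ≡ true) →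
  all p (allFin n) ≡ true → all q (allFin n) ≡ true
all-mono {n} p q h ps = T⇒≡true (all⁻ q (All.universal (λ x → ≡true⇒T (h x (all-true p ps x))) (allFin n)))

any-mono : ∀ {A : Set} (p q : A → Bool) → (∀ x → p x ≡ true → q x ≡ true) → ∀ xs →
  any p xs ≡ true → any q xs ≡ true
any-mono p q h (x ∷ xs) e with p x in px
... | true  rewrite h x px = refl
... | false with q x
...   | true  = refl
...   | false = any-mono p q h xs e

expert-mono : ∀ {n} (a : Fin n) → Monotone (expert a)
expert-mono a {K} {K′} K⊆K′ = all-mono (K a) (K′ a) (K⊆K′ a)

someExpert-mono : ∀ {n} → Monotone (someExpert {n})
someExpert-mono {n} {K} {K′} K⊆K′ =
  any-mono (λ a → expert a K) (λ a → expert a K′) (λ a → expert-mono a K⊆K′) (allFin n)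

allExperts-mono : ∀ {n} → Monotone (allExperts {n})
allExperts-mono {n} {K} {K′} K⊆K′ =
  all-mono (λ a → expert a K) (λ a → expert a K′) (λ a → expert-mono a K⊆K′)

exchanged-mono : ∀ {n} (a b : Fin n) → Monotone (exchanged a b)
exchanged-mono a b {K} {K′} K⊆K′ h
  with p , q ← Equivalence.to (T-∧ {K a b}) (≡true⇒T h)
  rewrite K⊆K′ a b (T⇒≡true p) = K⊆K′ b a (T⇒≡true q)

run-++ : ∀ {n} (K : Know n) σ t → run K σ ≡ run (run K (take t σ)) (drop t σ)
run-++ K []      zero    = refl
run-++ K []      (suc t) = refl
run-++ K (c ∷ σ) zero    = refl
run-++ K (c ∷ σ) (suc t) = run-++ (step c K) σ t

size-zero : ∀ {n} (I : Fin n → Bool) → (size I ≡ᵇ 0) ≡ false → ∃ λ a → I a ≡ true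
size-zero {n} I h = go (allFin n) h
  where
  go : ∀ xs → (∑ xs (λ a → ⟦ I a ⟧) ≡ᵇ 0) ≡ false → ∃ λ a → I a ≡ true
  go (x ∷ xs) h with I x in eq
  ... | true  = x , eq
  ... | false = go xs h

-- An agent untouched by the last calls must already have been an expert before them.
allExperts-split : ∀ {n} τ ρ → ⟦ allExperts {n} (run (run initial τ) ρ) ⟧
  ≤ ⟦ someExpert (run initial τ) ⟧ + ⟦ size (untouched ρ) ≡ᵇ 0 ⟧
allExperts-split {n} τ ρ with size (untouched ρ) ≡ᵇ 0 in eq
... | true  = ≤-trans ⟦ allExperts (run (run initial τ) ρ) ⟧≤1 (m≤n+m 1 _)
... | false with a , free ← size-zero (untouched ρ) eq = ≤-trans (⇒⟦⟧≤ some) (m≤m+n _ 0)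
  where
  some : allExperts (run (run initial τ) ρ) ≡ true → someExpert (run initial τ) ≡ true
  some h = any-true (λ x → expert x (run initial τ)) a
    (all-mono (run (run initial τ) ρ a) (run initial τ a)
      (λ s → trans (sym (run-untouched (run initial τ) ρ a s free)))
      (all-true (λ x → expert x (run (run initial τ) ρ)) h a))

-- The first t and the last u calls are independent, so each of the two events is counted with the
-- other stretch left free.
count-allExperts-≤ : ∀ n t u → let N = length (pairs n) in
  count n allExperts (t + u)
    ≤ N ^ u * count n someExpert t + N ^ t * ∑ (seqs n u) (λ ρ → ⟦ size (untouched ρ) ≡ᵇ 0 ⟧)
count-allExperts-≤ n t u = begin
  count n allExperts (t + u)
    ≡⟨ ∑-cong (seqs n (t + u)) (λ σ → cong (λ K → ⟦ allExperts K ⟧) (run-++ initial σ t)) ⟩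
  ∑ (seqs n (t + u)) (λ σ → ⟦ allExperts (run (run initial (take t σ)) (drop t σ)) ⟧)
    ≡⟨ ∑-seqs-split t u (λ τ ρ → ⟦ allExperts (run (run initial τ) ρ) ⟧) ⟩
  ∑ (seqs n t) (λ τ → ∑ (seqs n u) (λ ρ → ⟦ allExperts (run (run initial τ) ρ) ⟧))
    ≤⟨ ∑-mono (seqs n t) (λ τ → ∑-mono (seqs n u) (allExperts-split τ)) ⟩
  ∑ (seqs n t) (λ τ → ∑ (seqs n u) (λ ρ → S τ + Z ρ))
    ≡⟨ ∑-cong (seqs n t) (λ τ → trans (∑-+ (λ _ → S τ) Z (seqs n u)) (cong (_+ ∑ (seqs n u) Z) (∑-seqs-const u (S τ)))) ⟩
  ∑ (seqs n t) (λ τ → N ^ u * S τ + ∑ (seqs n u) Z)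
    ≡⟨ ∑-+ (λ τ → N ^ u * S τ) _ (seqs n t) ⟩
  ∑ (seqs n t) (λ τ → N ^ u * S τ) + ∑ (seqs n t) (λ _ → ∑ (seqs n u) Z)
    ≡⟨ cong₂ _+_ (∑-*ˡ (N ^ u) S (seqs n t)) (∑-seqs-const t _) ⟩
  N ^ u * count n someExpert t + N ^ t * ∑ (seqs n u) Z ∎
  where
  open ≤-Reasoning
  N = length (pairs n)
  S Z : List (Call n) → ℕ
  S τ = ⟦ someExpert (run initial τ) ⟧
  Z ρ = ⟦ size (untouched ρ) ≡ᵇ 0 ⟧

absorb : ∀ x c K {Y Z P} .{{_ : NonZero x}} → x * Z ≤ c * Y → K * c * Y ≤ P * x → K * Z ≤ P
absorb x c K {Y} {Z} {P} h₁ h₂ = *-cancelʳ-≤ _ _ x (begin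
  K * Z * x      ≡⟨ lemma K Z x ⟩
  K * (x * Z)    ≤⟨ *-monoʳ-≤ K h₁ ⟩
  K * (c * Y)    ≡⟨ *-assoc K c Y ⟨
  K * c * Y      ≤⟨ h₂ ⟩
  P * x          ∎)
  where
  open ≤-Reasoning
  lemma : ∀ k z x → k * z * x ≡ k * (x * z)
  lemma = solve-∀

-- The form of the union bound over agents: every single estimate carries the spare factor n that
-- pays for it.
average≤max : ∀ {n} .{{_ : NonZero n}} K (V : Fin n → ℕ) {P} → (∀ i → K * (n * V i) ≤ P) → K * ∑ᶠ V ≤ P
average≤max {n} K V {P} hyp = *-cancelˡ-≤ n (begin
  n * (K * ∑ᶠ V)               ≡⟨ *-assoc n K _ ⟨
  n * K * ∑ᶠ V                 ≡⟨ ∑-*ˡ (n * K) V (allFin n) ⟨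
  ∑ᶠ (λ i → n * K * V i)       ≤⟨ ∑-mono (allFin n) (λ i → ≤-trans (≤-reflexive (lemma n K (V i))) (hyp i)) ⟩
  ∑ᶠ {n} (λ _ → P)             ≡⟨ ∑ᶠ-const n P ⟩
  n * P                        ∎)
  where
  open ≤-Reasoning
  lemma : ∀ n k v → n * k * v ≡ k * (n * v)
  lemma = solve-∀

m≤m^[1+n] : ∀ m n → m ≤ m ^ suc n
m≤m^[1+n] zero      n = z≤n
m≤m^[1+n] m@(suc _) n = m≤m*n m (m ^ n) {{m^n≢0 m n}}

-- Assembling the four windows

module Main (d k : ℕ) where

  private
    f² : ℕ
    f² = fact (suc d) * fact (suc d)
    -- Twice the 2 (k + 1) that `window` asks for, because two of the tails split into two events.
    -- `K₁`, `K₂`, `K₃` include the constants 3, (s!)² and 1 + e of the Markov bounds, and their sum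
    -- g satisfies g < 2^g.
    κ : ℕ
    κ = 4 * suc k
    K₁ K₂ K₃ : ℕ
    K₁ = κ * 3
    K₂ = κ * f²
    K₃ = κ * suc (2 * d + 3)
    g : ℕ
    g = K₁ + K₂ + K₃

  open Parameters d g

  private
    K₁≤ : K₁ ≤ 2 ^ g
    K₁≤ = ≤-trans (≤-trans (m≤m+n K₁ K₂) (m≤m+n _ K₃)) (<⇒≤ (n<2^n g))
    K₂≤ : K₂ ≤ 2 ^ g
    K₂≤ = ≤-trans (≤-trans (m≤n+m K₂ K₁) (m≤m+n _ K₃)) (<⇒≤ (n<2^n g))
    K₃≤ : K₃ ≤ 2 ^ g
    K₃≤ = ≤-trans (m≤n+m K₃ (K₁ + K₂)) (<⇒≤ (n<2^n g))

  -- The first summand gives `n-large`, the second gives r₀ ≤ r through `bracket`; the leading `suc`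
  -- leaves the same bound for n - 1.
  threshold : ℕ
  threshold = suc ((1 + s) * (M + 1) + b ^ (R * r₀))

  module Large (n′ : ℕ) (large : (1 + s) * (M + 1) + b ^ (R * r₀) ≤ n′) where

    n N : ℕ
    n = suc n′
    N = length (pairs n)

    n′≢0 : NonZero n′
    n′≢0 = >-nonZero (≤-trans (s≤s z≤n) (≤-trans (m≤m+n ((1 + s) * (M + 1)) _) large))

    n-large : (n + s) * b ≤ (M + 3) * n′
    n-large = begin
      (n + s) * b                          ≡⟨ lemma₁ n′ s M ⟩
      n′ * b + (1 + s) * (M + 1)           ≤⟨ +-monoʳ-≤ (n′ * b) (≤-trans (m≤m+n _ _) large) ⟩
      n′ * b + n′                          ≤⟨ m≤m+n _ n′ ⟩
      n′ * b + n′ + n′                     ≡⟨ lemma₂ n′ M ⟩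
      (M + 3) * n′                         ∎
      where
      open ≤-Reasoning
      lemma₁ : ∀ n s M → (1 + n + s) * (M + 1) ≡ n * (M + 1) + (1 + s) * (M + 1)
      lemma₁ = solve-∀
      lemma₂ : ∀ n M → n * (M + 1) + n + n ≡ (M + 3) * n
      lemma₂ = solve-∀

    private
      M≤R : M ≤ R
      M≤R = ≤-trans (m≤m*n M (2 * s * (M + 1))) (≤-reflexive (lemma s M))
        where
        lemma : ∀ s M → M * (2 * s * (M + 1)) ≡ 2 * s * M * (M + 1)
        lemma = solve-∀

      n≥base : b ^ (R * r₀) ≤ n * M ^ (R * r₀)
      n≥base = begin
        b ^ (R * r₀)          ≤⟨ m≤n+m (b ^ (R * r₀)) ((1 + s) * (M + 1)) ⟩
        (1 + s) * (M + 1) + b ^ (R * r₀) ≤⟨ large ⟩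
        n′                    ≤⟨ n≤1+n n′ ⟩
        n                     ≤⟨ m≤m*n n (M ^ (R * r₀)) {{m^n≢0 M (R * r₀)}} ⟩
        n * M ^ (R * r₀)      ∎
        where open ≤-Reasoning

      logarithm = bracket R M≤R n r₀ n≥base
      r = proj₁ logarithm

    open Times {n} {n′} {N} {r} refl n′≢0 (2*∣pairs∣ n) n-large (proj₁ (proj₂ logarithm))
      (proj₁ (proj₂ (proj₂ logarithm))) (proj₂ (proj₂ (proj₂ logarithm)))

    private
      n′e≤[1+e]N : n′ * e ≤ suc e * N
      n′e≤[1+e]N = begin
        n′ * e       ≡⟨ *-comm n′ e ⟩
        e * n′       ≤⟨ *-mono-≤ (n≤1+n e) n′≤N ⟩
        suc e * N    ∎
        where
        open ≤-Reasoning
        n′≤N : n′ ≤ N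
        n′≤N = *-cancelˡ-≤ 2 (≤-trans (*-monoˡ-≤ n′ (s≤s (>-nonZero⁻¹ n′ {{n′≢0}}))) (≤-reflexive (sym 2N≡nn′)))

      B : ℕ
      B = proj₁ (m≤n⇒∃[o]m+o≡n n′e≤[1+e]N)
      B-def : B + n′ * e ≡ suc e * N
      B-def = trans (+-comm B (n′ * e)) (proj₂ (m≤n⇒∃[o]m+o≡n n′e≤[1+e]N))

    open SlowSpread {n} {n′} refl e B B-def using (count-not-reach-≤)

    ignorance : Fin n → Fin n → ℕ → ℕ
    ignorance a s t = ∑ (seqs n t) (λ σ → ⟦ not (run initial σ a s) ⟧)

    -- Each of the `suc q` stretches of length `hi` gains a factor n. One is used up by the factor 1
    -- + e n of `count-not-reach-≤`; the other q pay for a union over 1, n or n² pairs.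
    ignorance-bound : ∀ q a s → κ * (n ^ q * ignorance a s (suc q * hi)) ≤ N ^ (suc q * hi)
    ignorance-bound q a s = absorb (suc e ^ t) (suc e) κ {Y = n ^ suc q * B ^ t} {{m^n≢0 (suc e) t}}
      (begin
        suc e ^ t * (n ^ q * ignorance a s t)
          ≡⟨ cong (λ z → suc e ^ t * (n ^ q * z)) (∑-cong (seqs n t) (λ σ → cong (λ b → ⟦ not b ⟧) (run≡reach σ a s))) ⟩
        suc e ^ t * (n ^ q * Z)
          ≡⟨ lemma₁ (suc e ^ t) (n ^ q) Z ⟩
        n ^ q * (suc e ^ t * Z)
          ≤⟨ *-monoʳ-≤ (n ^ q) (count-not-reach-≤ a s t) ⟩
        n ^ q * (suc (e * n) * B ^ t)
          ≤⟨ *-monoʳ-≤ (n ^ q) (*-monoˡ-≤ (B ^ t) (+-monoˡ-≤ (e * n) (s≤s {n = n′} z≤n))) ⟩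
        n ^ q * (suc e * n * B ^ t)
          ≡⟨ lemma₂ (n ^ q) (suc e) n (B ^ t) ⟩
        suc e * (n ^ suc q * B ^ t) ∎)
      (begin
        K₃ * (n ^ suc q * B ^ t)
          -- Raising `K₃` to the same power makes the whole expression a power of the estimate for
          -- one stretch.
          ≤⟨ *-monoˡ-≤ _ (m≤m^[1+n] K₃ q) ⟩
        K₃ ^ suc q * (n ^ suc q * B ^ t)
          ≡⟨ cong (λ z → K₃ ^ suc q * (n ^ suc q * z)) (power B) ⟨
        K₃ ^ suc q * (n ^ suc q * (B ^ hi) ^ suc q)
          ≡⟨ trans (cong (K₃ ^ suc q *_) (sym (^-distribʳ-* (suc q) n (B ^ hi)))) (sym (^-distribʳ-* (suc q) K₃ (n * B ^ hi))) ⟩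
        (K₃ * (n * B ^ hi)) ^ suc q
          ≤⟨ ^-monoˡ-≤ (suc q) (≤-trans (≤-reflexive (sym (*-assoc K₃ n (B ^ hi)))) (decay {K₃} B-def K₃≤)) ⟩
        ((suc e * N) ^ hi) ^ suc q
          ≡⟨ power (suc e * N) ⟩
        (suc e * N) ^ t
          ≡⟨ trans (^-distribʳ-* t (suc e) N) (*-comm (suc e ^ t) (N ^ t)) ⟩
        N ^ t * suc e ^ t ∎)
      where
      open ≤-Reasoning
      t = suc q * hi
      Z = ∑ (seqs n t) (λ σ → ⟦ not (reach σ a s) ⟧)
      power : ∀ x → (x ^ hi) ^ suc q ≡ x ^ t
      power x = trans (^-*-assoc x hi (suc q)) (cong (x ^_) (*-comm hi (suc q)))
      lemma₁ : ∀ x y z → x * (y * z) ≡ y * (x * z)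
      lemma₁ = solve-∀
      lemma₂ : ∀ x y z w → x * (y * z * w) ≡ y * (z * x * w)
      lemma₂ = solve-∀

    private
      half : ∀ {Z P} → κ * Z ≤ P → 2 * suc k * Z ≤ P
      half {Z} hyp = ≤-trans (*-monoˡ-≤ Z (*-monoˡ-≤ (suc k) (s≤s (s≤s (z≤n {2}))))) hyp

      halves : ∀ {Z Z′ P} → κ * Z ≤ P → κ * Z′ ≤ P → 2 * suc k * (Z + Z′) ≤ P
      halves {Z} {Z′} {P} h₁ h₂ = *-cancelˡ-≤ 2 (begin
        2 * (2 * suc k * (Z + Z′))    ≡⟨ lemma (suc k) Z Z′ ⟩
        κ * Z + (κ * Z′ + 0)          ≤⟨ +-mono-≤ h₁ (+-monoˡ-≤ 0 h₂) ⟩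
        2 * P                         ∎)
        where
        open ≤-Reasoning
        lemma : ∀ k z z′ → 2 * (2 * k * (z + z′)) ≡ 4 * k * z + (4 * k * z′ + 0)
        lemma = solve-∀

    count-not-expert-≤ : ∀ a t → count n (not ∘ expert a) t ≤ ∑ᶠ (λ s → ignorance a s t)
    count-not-expert-≤ a t = ≤-trans
      (∑-mono (seqs n t) (λ σ → ⟦not-all⟧≤∑ (run initial σ a) (allFin n)))
      (≤-reflexive (∑-swap (λ σ s → ⟦ not (run initial σ a s) ⟧) (seqs n t) (allFin n)))

    late-exchanged : ∀ a b → 2 * suc k * count n (not ∘ exchanged a b) (1 * hi) ≤ N ^ (1 * hi)
    late-exchanged a b = ≤-trans (*-monoʳ-≤ (2 * suc k) split) (halves (single a b) (single b a))
      where
      single : ∀ a b → κ * ignorance a b (1 * hi) ≤ N ^ (1 * hi)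
      single a b = subst (λ z → κ * z ≤ N ^ (1 * hi)) (*-identityˡ _) (ignorance-bound 0 a b)
      pointwise : ∀ x y → ⟦ not (x ∧ y) ⟧ ≤ ⟦ not x ⟧ + ⟦ not y ⟧
      pointwise true  y = ≤-refl
      pointwise false y = s≤s z≤n
      split : count n (not ∘ exchanged a b) (1 * hi) ≤ ignorance a b (1 * hi) + ignorance b a (1 * hi)
      split = ≤-trans (∑-mono (seqs n (1 * hi)) (λ σ → pointwise (run initial σ a b) (run initial σ b a)))
        (≤-reflexive (∑-+ (λ σ → ⟦ not (run initial σ a b) ⟧) (λ σ → ⟦ not (run initial σ b a) ⟧) (seqs n (1 * hi))))

    late-expert : ∀ a → 2 * suc k * count n (not ∘ expert a) (2 * hi) ≤ N ^ (2 * hi)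
    late-expert a = half (≤-trans (*-monoʳ-≤ κ (count-not-expert-≤ a (2 * hi)))
      (average≤max κ (λ s → ignorance a s (2 * hi)) (λ s →
        subst (λ z → κ * (z * ignorance a s (2 * hi)) ≤ N ^ (2 * hi)) (*-identityʳ n) (ignorance-bound 1 a s))))

    late-someExpert : 2 * suc k * count n (not ∘ someExpert) (2 * hi) ≤ N ^ (2 * hi)
    late-someExpert = ≤-trans (*-monoʳ-≤ (2 * suc k) (∑-mono (seqs n (2 * hi)) (λ σ →
      ⇒⟦not⟧≤ (any-true (λ a → expert a (run initial σ)) zero)))) (late-expert zero)

    late-allExperts : 2 * suc k * count n (not ∘ allExperts) (3 * hi) ≤ N ^ (3 * hi)
    late-allExperts = half (≤-trans (*-monoʳ-≤ κ split) (average≤max κ (λ a → ∑ᶠ (λ s → ignorance a s (3 * hi)))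
      (λ a → subst (λ z → κ * z ≤ N ^ (3 * hi)) (∑-*ˡ n (λ s → ignorance a s (3 * hi)) (allFin n))
        (average≤max κ (λ s → n * ignorance a s (3 * hi)) (λ s →
          subst (λ z → κ * z ≤ N ^ (3 * hi)) (lemma n (ignorance a s (3 * hi))) (ignorance-bound 2 a s))))))
      where
      lemma : ∀ n z → n * (n * 1) * z ≡ n * (n * z)
      lemma = solve-∀
      split : count n (not ∘ allExperts) (3 * hi) ≤ ∑ᶠ (λ a → ∑ᶠ (λ s → ignorance a s (3 * hi)))
      split = ≤-trans (∑-mono (seqs n (3 * hi)) (λ σ → ⟦not-all⟧≤∑ (λ a → expert a (run initial σ)) (allFin n)))
        (≤-trans (≤-reflexive (∑-swap (λ σ a → ⟦ not (expert a (run initial σ)) ⟧) (seqs n (3 * hi)) (allFin n)))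
          (∑-mono (allFin n) (λ a → count-not-expert-≤ a (3 * hi))))

    early-bound : ∀ {Z} t → t ≡ lo → n * Z ≤ 3 * (N + n) ^ t → κ * Z ≤ N ^ t
    early-bound t refl hyp = absorb n 3 κ {Y = (N + n) ^ lo} hyp (growth-half {K₁} K₁≤)

    early-exchanged : ∀ a b → a ≢ b → 2 * suc k * count n (exchanged a b) (1 * lo) ≤ N ^ (1 * lo)
    early-exchanged a b a≢b = half (early-bound (1 * lo) (*-identityˡ lo) (begin
      n * count n (exchanged a b) (1 * lo)
        ≤⟨ *-monoʳ-≤ n (∑-mono (seqs n (1 * lo)) (λ σ → ≤-trans
             (pointwise (run initial σ a b) (run initial σ b a))
             (≤-reflexive (cong ⟦_⟧ (run≡reach σ a b))))) ⟩
      n * ∑ (seqs n (1 * lo)) (λ σ → ⟦ reach σ a b ⟧)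
        ≤⟨ count-reach-≤ a≢b (1 * lo) ⟩
      (N + n) ^ (1 * lo)
        ≤⟨ m≤n*m _ 3 ⟩
      3 * (N + n) ^ (1 * lo) ∎))
      where
      open ≤-Reasoning
      pointwise : ∀ x y → ⟦ x ∧ y ⟧ ≤ ⟦ x ⟧
      pointwise true  y = ⟦ y ⟧≤1
      pointwise false y = z≤n

    -- Kept with κ because the early tail for all experts spends only half of its allowance on this
    -- event.
    early-someExpert′ : κ * count n someExpert (2 * lo) ≤ N ^ (2 * lo)
    early-someExpert′ = absorb (n ^ (d + suc d)) f² κ {Y = A ^ (2 * lo)} {{m^n≢0 n (d + suc d)}} bound (growth-full {K₂} K₂≤)
      where
      open ≤-Reasoning
      A = N + s * (n + s)
      E : Fin n → ℕ
      E a = count n (expert a) (2 * lo)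
      union : count n someExpert (2 * lo) ≤ ∑ᶠ E
      union = ≤-trans (∑-mono (seqs n (2 * lo)) (λ σ → ⟦any⟧≤∑ (λ a → expert a (run initial σ)) (allFin n)))
        (≤-reflexive (∑-swap (λ σ a → ⟦ expert a (run initial σ) ⟧) (seqs n (2 * lo)) (allFin n)))
      bound : n ^ (d + suc d) * count n someExpert (2 * lo) ≤ f² * A ^ (2 * lo)
      bound = ≤-trans (*-monoʳ-≤ (n ^ (d + suc d)) union) (average≤max (n ^ (d + suc d)) E (λ a → begin
        n ^ (d + suc d) * (n * E a)      ≡⟨ lemma (n ^ (d + suc d)) n (E a) ⟩
        E a * n ^ (s + s)                ≤⟨ FastSpread.count-expert-≤ s a (2 * lo) ⟩
        A ^ (2 * lo) * f²                 ≡⟨ *-comm (A ^ (2 * lo)) f² ⟩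
        f² * A ^ (2 * lo)                 ∎))
        where
        lemma : ∀ x n z → x * (n * z) ≡ z * (n * x)
        lemma = solve-∀

    early-someExpert : 2 * suc k * count n someExpert (2 * lo) ≤ N ^ (2 * lo)
    early-someExpert = half early-someExpert′

    early-expert : ∀ a → 2 * suc k * count n (expert a) (2 * lo) ≤ N ^ (2 * lo)
    early-expert a = ≤-trans (*-monoʳ-≤ (2 * suc k) (∑-mono (seqs n (2 * lo)) (λ σ →
      ⇒⟦⟧≤ (any-true (λ x → expert x (run initial σ)) a)))) early-someExpert

    early-allExperts : 2 * suc k * count n allExperts (3 * lo) ≤ N ^ (3 * lo)
    early-allExperts = subst (λ t → 2 * suc k * count n allExperts t ≤ N ^ t) (lemma lo)
      (≤-trans (*-monoʳ-≤ (2 * suc k) (count-allExperts-≤ n (2 * lo) lo)) (halves first second))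
      where
      open ≤-Reasoning
      S = count n someExpert (2 * lo)
      Z = ∑ (seqs n lo) (λ ρ → ⟦ size (untouched ρ) ≡ᵇ 0 ⟧)
      lemma : ∀ lo → 2 * lo + lo ≡ 3 * lo
      lemma = solve-∀
      swap : ∀ x y z → x * (y * z) ≡ y * (x * z)
      swap = solve-∀
      first : κ * (N ^ lo * S) ≤ N ^ (2 * lo + lo)
      first = begin
        κ * (N ^ lo * S)           ≡⟨ swap κ (N ^ lo) S ⟩
        N ^ lo * (κ * S)           ≤⟨ *-monoʳ-≤ (N ^ lo) early-someExpert′ ⟩
        N ^ lo * N ^ (2 * lo)       ≡⟨ *-comm (N ^ lo) _ ⟩
        N ^ (2 * lo) * N ^ lo       ≡⟨ ^-distribˡ-+-* N (2 * lo) lo ⟨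
        N ^ (2 * lo + lo)           ∎
      second : κ * (N ^ (2 * lo) * Z) ≤ N ^ (2 * lo + lo)
      second = begin
        κ * (N ^ (2 * lo) * Z)     ≡⟨ swap κ (N ^ (2 * lo)) Z ⟩
        N ^ (2 * lo) * (κ * Z)     ≤⟨ *-monoʳ-≤ (N ^ (2 * lo)) (early-bound lo refl (Untouched.count-none-untouched-≤ n lo)) ⟩
        N ^ (2 * lo) * N ^ lo       ≡⟨ ^-distribˡ-+-* N (2 * lo) lo ⟨
        N ^ (2 * lo + lo)           ∎

    exchanged-window : ∀ a b → a ≢ b → Window n 1 2 d k (exchanged a b)
    exchanged-window a b a≢b = window 1 2 d k (λ {K} → exchanged-mono a b {K}) (1 * lo) (1 * hi) (*-monoʳ-≤ 1 lo≤hi)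
      (expGe-lower 1 2 1 refl) (expLe-upper 1 2 1 refl) (early-exchanged a b a≢b) (late-exchanged a b)

    someExpert-window : Window n 1 1 d k someExpert
    someExpert-window = window 1 1 d k (λ {K} → someExpert-mono {n} {K}) (2 * lo) (2 * hi) (*-monoʳ-≤ 2 lo≤hi)
      (expGe-lower 1 1 2 refl) (expLe-upper 1 1 2 refl) early-someExpert late-someExpert

    expert-window : ∀ a → Window n 1 1 d k (expert a)
    expert-window a = window 1 1 d k (λ {K} → expert-mono a {K}) (2 * lo) (2 * hi) (*-monoʳ-≤ 2 lo≤hi)
      (expGe-lower 1 1 2 refl) (expLe-upper 1 1 2 refl) (early-expert a) (late-expert a)

    allExperts-window : Window n 3 2 d k allExperts
    allExperts-window = window 3 2 d k (λ {K} → allExperts-mono {n} {K}) (3 * lo) (3 * hi) (*-monoʳ-≤ 3 lo≤hi)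
      (expGe-lower 3 2 3 refl) (expLe-upper 3 2 3 refl) early-allExperts late-allExperts

theorem6p5 : (d k : ℕ) → Σ ℕ λ N → (n : ℕ) → N ≤ n →
    ((a b : Fin n) → a ≢ b → Window n 1 2 d k (exchanged a b))
    × Window n 1 1 d k someExpert
    × ((a : Fin n) → Window n 1 1 d k (expert a))
    × Window n 3 2 d k allExperts
theorem6p5 d k = Main.threshold d k , λ { (suc n′) (s≤s large) → let open Main.Large d k n′ large in
  exchanged-window , someExpert-window , expert-window , allExperts-window }
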